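{- For every integer $n\geq 1$, $$F_{n}(y,t)=\frac{1}{1+t}\left(B_{n}(y,t^{2})+\frac{1}{t}\sum_{k=0}^{n}(-1)^{n-k}\binom{n}{k}(1-t^{2})^{n-k}B_{k}(y,t^{2})\right).$$
   Context: $\mathfrak{B}_n$ is the set of signed permutations: permutations $\pi$ of $\{ -n,\dots,-1,0,1,\dots,n\}$ with $\pi_{ -i}=-\pi_i$ for all $i$ (so $\pi_0=0$), written $\pi=\pi_1\cdots\pi_n$. For $\pi\in\mathfrak{B}_n$: $\mathrm{des}_B(\pi)$ is the number of $i\in\{0,1,\dots,n-1\}$ with $\pi_i>\pi_{i+1}$ (where $\pi_0=0$); the flag descent number $\mathrm{fdes}(\pi)$ is $2\,\mathrm{des}_B(\pi)$ if $\pi_1>0$ and $2\,\mathrm{des}_B(\pi)-1$ if $\pi_1<0$; $\mathrm{neg}(\pi)$ is the number of $i\in\{1,\dots,n\}$ with $\pi_i<0$. For $n\ge1$, $B_n(y,t)=\sum_{\pi\in\mathfrak{B}_n}y^{\mathrm{neg}(\pi)}t^{\mathrm{des}_B(\pi)}$ and $F_n(y,t)=\sum_{\pi\in\mathfrak{B}_n}y^{\mathrm{neg}(\pi)}t^{\mathrm{fdes}(\pi)}$; also $B_0(y,t)=1$. The identity is one of rational functions in the indeterminates $y,t$. -}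

module Defs where

open import Algebra.Bundles using (CommutativeRing)
open import Data.Bool.Base using (if_then_else_)
open import Data.Empty using (⊥-elim)
open import Data.Fin.Base using (Fin; zero; suc; toℕ; inject₁; opposite; finToFun; _↑ʳ_)
open import Data.Fin.Properties using (all?; any?)
import Data.Fin.Properties as Fin
open import Data.Integer.Base as ℤ using (ℤ; 0ℤ; _⊖_)
import Data.Integer.Properties as ℤ
open import Data.List.Base using (List; []; _∷_; map; filter; foldr; allFin)
open import Data.Nat.Base as ℕ using (ℕ; zero; suc; _∸_; NonZero)
open import Data.Product.Base using (_,_; proj₁; proj₂)
open import Data.Sum.Base as Sum using (_⊎_; inj₁; inj₂; [_,_]′)
import Data.Vec.Base as Vec
open import Function.Base using (_∘_)
open import Function.Definitions using (Injective; Surjective; Bijective)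
open import Level using (Level; _⊔_; 0ℓ) renaming (suc to lsuc)
open import Relation.Binary.PropositionalEquality.Core as ≡ using (_≡_; refl)
open import Relation.Nullary using (¬_; Dec; does; map′; _×-dec_; _→-dec_)

private variable
  c ℓ : Level
  n : ℕ

-- The set {-n,…,-1,0,1,…,n}: the element k of Fin (n + suc n) stands for the
-- integer toℕ k - n.  Negation is then the library's `opposite`.

±[_] : ℕ → Set
±[ n ] = Fin (n ℕ.+ suc n)

value : ∀ n → ±[ n ] → ℤ
value n k = toℕ k ⊖ n

-- The element of {-n,…,n} whose value is i, for 0 ≤ i ≤ n.

pos : ∀ n → Fin (suc n) → ±[ n ]
pos n i = n ↑ʳ i

record IsSignedPermutation (π : ±[ n ] → ±[ n ]) : Set where
  field
    bijective : Bijective _≡_ _≡_ π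
    odd       : ∀ k → π (opposite k) ≡ opposite (π k)

isSignedPermutation? : (π : ±[ n ] → ±[ n ]) → Dec (IsSignedPermutation π)
isSignedPermutation? π = map′
  (λ (b , o) → record { bijective = b ; odd = o })
  (λ p → let open IsSignedPermutation p in bijective , odd)
  ((injective? ×-dec surjective?) ×-dec
    all? (λ k → π (opposite k) Fin.≟ opposite (π k)))
  where
  injective? : Dec (Injective _≡_ _≡_ π)
  injective? = map′ (λ f {x} {y} → f x y) (λ f x y → f {x} {y})
    (all? λ x → all? λ y → (π x Fin.≟ π y) →-dec (x Fin.≟ y))

  surjective? : Dec (Surjective _≡_ _≡_ π)
  surjective? = map′
    (λ f y → proj₁ (f y) , λ { refl → proj₂ (f y) })
    (λ f y → proj₁ (f y) , proj₂ (f y) refl)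
    (all? λ y → any? λ x → π x Fin.≟ y)

-- `finToFun` runs through all functions {-n,…,n} → {-n,…,n}, each exactly once
-- up to pointwise equality, so 𝔅 n lists every signed permutation exactly once.

𝔅 : ∀ n → List (±[ n ] → ±[ n ])
𝔅 n = filter isSignedPermutation?
  (map finToFun (allFin ((n ℕ.+ suc n) ℕ.^ (n ℕ.+ suc n))))

entry : ∀ n → (±[ n ] → ±[ n ]) → Fin (suc n) → ℤ
entry n π i = value n (π (pos n i))

desB : ∀ n → (±[ n ] → ±[ n ]) → ℕ
desB n π = Vec.count (λ i → entry n π (suc i) ℤ.<? entry n π (inject₁ i)) (Vec.allFin n)

neg : ∀ n → (±[ n ] → ±[ n ]) → ℕ
neg n π = Vec.count (λ i → entry n π (suc i) ℤ.<? 0ℤ) (Vec.allFin n)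

-- The truncated subtraction is harmless: if π₁ < 0 = π₀ then 0 is a descent.

fdes : ∀ n .{{_ : NonZero n}} → (±[ n ] → ±[ n ]) → ℕ
fdes n@(suc _) π =
  if does (entry n π (suc zero) ℤ.<? 0ℤ) then 2 ℕ.* desB n π ∸ 1 else 2 ℕ.* desB n π

-- The polynomials B_n and F_n, as functions of two elements of any
-- commutative ring.

module DescentPolynomials (R : CommutativeRing c ℓ) where
  open CommutativeRing R using (Carrier; _+_; _*_; 0#; 1#; semiring)
  open import Algebra.Properties.Semiring.Exp semiring using (_^_)

  ∑𝔅 : ∀ n → ((±[ n ] → ±[ n ]) → Carrier) → Carrier
  ∑𝔅 n f = foldr _+_ 0# (map f (𝔅 n))

  B : ℕ → Carrier → Carrier → Carrier
  B zero      y t = 1#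
  B n@(suc _) y t = ∑𝔅 n λ π → y ^ neg n π * t ^ desB n π

  F : (n : ℕ) .{{_ : NonZero n}} → Carrier → Carrier → Carrier
  F n@(suc _) y t = ∑𝔅 n λ π → y ^ neg n π * t ^ fdes n π

record IntegralDomain c ℓ : Set (lsuc (c ⊔ ℓ)) where
  field
    commutativeRing : CommutativeRing c ℓ
  open CommutativeRing commutativeRing public
  field
    1≉0            : ¬ 1# ≈ 0#
    noZeroDivisors : ∀ x y → x * y ≈ 0# → x ≈ 0# ⊎ y ≈ 0#

ℤ-domain : IntegralDomain 0ℓ 0ℓ
ℤ-domain = record
  { commutativeRing = ℤ.+-*-commutativeRing
  ; 1≉0             = λ ()
  ; noZeroDivisors  = λ x y → ℤ.i*j≡0⇒i≡0∨j≡0 x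
  }

module Polynomial (D : IntegralDomain c ℓ) where
  open IntegralDomain D hiding (1≉0; noZeroDivisors) renaming (refl to ≈-refl)
  private module D = IntegralDomain D
  open import Algebra.Properties.Ring ring using (-0#≈0#)
  open import Algebra.Properties.CommutativeSemigroup +-commutativeSemigroup
    using (interchange)

  infix  4 _≋_
  infixl 6 _⊕_
  infixl 7 _⊗_
  infixr 8 _·_

  -- a₀ ∷ a₁ ∷ … is a₀ + a₁ X + …; trailing zeros are allowed.

  Poly : Set c
  Poly = List Carrier

  coeff : Poly → ℕ → Carrier
  coeff []      _       = 0#
  coeff (a ∷ p) zero    = a
  coeff (a ∷ p) (suc i) = coeff p i

  record _≋_ (p q : Poly) : Set ℓ where
    constructor mk≋
    field coeff-≈ : ∀ i → coeff p i ≈ coeff q i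
  open _≋_ public

  _⊕_ : Poly → Poly → Poly
  []      ⊕ q       = q
  (a ∷ p) ⊕ []      = a ∷ p
  (a ∷ p) ⊕ (b ∷ q) = a + b ∷ p ⊕ q

  ⊖_ : Poly → Poly
  ⊖_ = map (-_)

  _·_ : Carrier → Poly → Poly
  a · p = map (a *_) p

  _⊗_ : Poly → Poly → Poly
  []      ⊗ q = []
  (a ∷ p) ⊗ q = a · q ⊕ (0# ∷ p ⊗ q)

  C : Carrier → Poly
  C a = a ∷ []

  X : Poly
  X = 0# ∷ 1# ∷ []

  coeff-⊕ : ∀ p q i → coeff (p ⊕ q) i ≈ coeff p i + coeff q i
  coeff-⊕ []      q       i       = sym (+-identityˡ _)
  coeff-⊕ (a ∷ p) []      i       = sym (+-identityʳ _)
  coeff-⊕ (a ∷ p) (b ∷ q) zero    = ≈-refl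
  coeff-⊕ (a ∷ p) (b ∷ q) (suc i) = coeff-⊕ p q i

  coeff-⊖ : ∀ p i → coeff (⊖ p) i ≈ - coeff p i
  coeff-⊖ []      i       = sym -0#≈0#
  coeff-⊖ (a ∷ p) zero    = ≈-refl
  coeff-⊖ (a ∷ p) (suc i) = coeff-⊖ p i

  coeff-· : ∀ a p i → coeff (a · p) i ≈ a * coeff p i
  coeff-· a []      i       = sym (zeroʳ a)
  coeff-· a (b ∷ p) zero    = ≈-refl
  coeff-· a (b ∷ p) (suc i) = coeff-· a p i

  ≋-refl : ∀ {p} → p ≋ p
  ≋-refl = mk≋ λ _ → ≈-refl

  ≋-sym : ∀ {p q} → p ≋ q → q ≋ p
  ≋-sym (mk≋ e) = mk≋ (sym ∘ e)

  ≋-trans : ∀ {p q r} → p ≋ q → q ≋ r → p ≋ r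
  ≋-trans (mk≋ e) (mk≋ f) = mk≋ λ i → trans (e i) (f i)

  ∷-cong : ∀ {a b p q} → a ≈ b → p ≋ q → a ∷ p ≋ b ∷ q
  ∷-cong e f = mk≋ λ { zero → e ; (suc i) → coeff-≈ f i }

  ∷≋[] : ∀ {a p} → a ≈ 0# → p ≋ [] → a ∷ p ≋ []
  ∷≋[] e f = mk≋ λ { zero → e ; (suc i) → coeff-≈ f i }

  tail-≋[] : ∀ {a p} → a ∷ p ≋ [] → p ≋ []
  tail-≋[] (mk≋ e) = mk≋ (e ∘ suc)

  ⊕-cong : ∀ {p p′ q q′} → p ≋ p′ → q ≋ q′ → p ⊕ q ≋ p′ ⊕ q′
  ⊕-cong {p} {p′} {q} {q′} e f = mk≋ λ i → trans (coeff-⊕ p q i)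
    (trans (+-cong (coeff-≈ e i) (coeff-≈ f i)) (sym (coeff-⊕ p′ q′ i)))

  ⊕-assoc : ∀ p q r → (p ⊕ q) ⊕ r ≋ p ⊕ (q ⊕ r)
  ⊕-assoc p q r = mk≋ λ i →
    trans (coeff-⊕ (p ⊕ q) r i) (trans (+-congʳ (coeff-⊕ p q i))
    (trans (+-assoc _ _ _)
    (sym (trans (coeff-⊕ p (q ⊕ r) i) (+-congˡ (coeff-⊕ q r i))))))

  ⊕-comm : ∀ p q → p ⊕ q ≋ q ⊕ p
  ⊕-comm p q = mk≋ λ i →
    trans (coeff-⊕ p q i) (trans (+-comm _ _) (sym (coeff-⊕ q p i)))

  ⊕-identityʳ : ∀ p → p ⊕ [] ≋ p
  ⊕-identityʳ p = mk≋ λ i → trans (coeff-⊕ p [] i) (+-identityʳ _)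

  ⊖-cong : ∀ {p q} → p ≋ q → ⊖ p ≋ ⊖ q
  ⊖-cong {p} {q} e = mk≋ λ i →
    trans (coeff-⊖ p i) (trans (-‿cong (coeff-≈ e i)) (sym (coeff-⊖ q i)))

  ⊖-inverseʳ : ∀ p → p ⊕ (⊖ p) ≋ []
  ⊖-inverseʳ p = mk≋ λ i → trans (coeff-⊕ p (⊖ p) i)
    (trans (+-congˡ (coeff-⊖ p i)) (-‿inverseʳ _))

  ⊖-inverseˡ : ∀ p → (⊖ p) ⊕ p ≋ []
  ⊖-inverseˡ p = ≋-trans (⊕-comm (⊖ p) p) (⊖-inverseʳ p)

  ⊕-interchange : ∀ p q r s → (p ⊕ q) ⊕ (r ⊕ s) ≋ (p ⊕ r) ⊕ (q ⊕ s)
  ⊕-interchange p q r s = mk≋ λ i →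
    trans (expand p q r s i)
      (trans (interchange _ _ _ _) (sym (expand p r q s i)))
    where
    expand : ∀ p q r s i → coeff ((p ⊕ q) ⊕ (r ⊕ s)) i ≈
             (coeff p i + coeff q i) + (coeff r i + coeff s i)
    expand p q r s i = trans (coeff-⊕ (p ⊕ q) (r ⊕ s) i)
      (+-cong (coeff-⊕ p q i) (coeff-⊕ r s i))

  ·-congˡ : ∀ a {p q} → p ≋ q → a · p ≋ a · q
  ·-congˡ a {p} {q} e = mk≋ λ i →
    trans (coeff-· a p i) (trans (*-congˡ (coeff-≈ e i)) (sym (coeff-· a q i)))

  ·-distribˡ : ∀ a p q → a · (p ⊕ q) ≋ a · p ⊕ a · q
  ·-distribˡ a p q = mk≋ λ i →
    trans (coeff-· a (p ⊕ q) i) (trans (*-congˡ (coeff-⊕ p q i))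
    (trans (distribˡ _ _ _)
    (sym (trans (coeff-⊕ (a · p) (a · q) i)
                (+-cong (coeff-· a p i) (coeff-· a q i))))))

  ·-assoc : ∀ a b p → (a * b) · p ≋ a · b · p
  ·-assoc a b p = mk≋ λ i →
    trans (coeff-· (a * b) p i) (trans (*-assoc _ _ _)
    (sym (trans (coeff-· a (b · p) i) (*-congˡ (coeff-· b p i)))))

  ·-zeroˡ : ∀ {a} → a ≈ 0# → ∀ p → a · p ≋ []
  ·-zeroˡ {a} e p = mk≋ λ i →
    trans (coeff-· a p i) (trans (*-congʳ e) (zeroˡ _))

  ·-identityˡ : ∀ p → 1# · p ≋ p
  ·-identityˡ p = mk≋ λ i → trans (coeff-· 1# p i) (*-identityˡ _)

  0∷[] : 0# ∷ [] ≋ []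
  0∷[] = ∷≋[] ≈-refl ≋-refl

  0∷-⊕ : ∀ p q → (0# ∷ p) ⊕ (0# ∷ q) ≋ 0# ∷ (p ⊕ q)
  0∷-⊕ p q = ∷-cong (+-identityˡ 0#) ≋-refl

  ·-0∷ : ∀ a p → a · (0# ∷ p) ≋ 0# ∷ a · p
  ·-0∷ a p = ∷-cong (zeroʳ a) ≋-refl

  ⊗-congˡ : ∀ p {q r} → q ≋ r → p ⊗ q ≋ p ⊗ r
  ⊗-congˡ []      e = ≋-refl
  ⊗-congˡ (a ∷ p) e =
    ⊕-cong (·-congˡ a e) (∷-cong ≈-refl (⊗-congˡ p e))

  ⊗-zeroʳ : ∀ p → p ⊗ [] ≋ []
  ⊗-zeroʳ []      = ≋-refl
  ⊗-zeroʳ (a ∷ p) = ∷≋[] ≈-refl (⊗-zeroʳ p)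

  ⊗-distribˡ : ∀ p q r → p ⊗ (q ⊕ r) ≋ p ⊗ q ⊕ p ⊗ r
  ⊗-distribˡ []      q r = ≋-refl
  ⊗-distribˡ (a ∷ p) q r = ≋-trans
    (⊕-cong (·-distribˡ a q r)
      (≋-trans (∷-cong ≈-refl (⊗-distribˡ p q r))
        (≋-sym (0∷-⊕ (p ⊗ q) (p ⊗ r)))))
    (⊕-interchange (a · q) (a · r) (0# ∷ p ⊗ q) (0# ∷ p ⊗ r))

  ⊗-∷ : ∀ p b q → p ⊗ (b ∷ q) ≋ b · p ⊕ (0# ∷ p ⊗ q)
  ⊗-∷ []      b q = ≋-sym 0∷[]
  ⊗-∷ (a ∷ p) b q = ∷-cong (+-congʳ (*-comm a b))
    (≋-trans (⊕-cong (≋-refl {a · q}) (⊗-∷ p b q))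
    (≋-trans (≋-sym (⊕-assoc (a · q) (b · p) (0# ∷ p ⊗ q)))
    (≋-trans (⊕-cong (⊕-comm (a · q) (b · p)) ≋-refl)
             (⊕-assoc (b · p) (a · q) (0# ∷ p ⊗ q)))))

  ⊗-comm : ∀ p q → p ⊗ q ≋ q ⊗ p
  ⊗-comm []      q = ≋-sym (⊗-zeroʳ q)
  ⊗-comm (a ∷ p) q = ≋-trans
    (⊕-cong (≋-refl {a · q}) (∷-cong ≈-refl (⊗-comm p q)))
    (≋-sym (⊗-∷ q a p))

  ⊗-cong : ∀ {p p′ q q′} → p ≋ p′ → q ≋ q′ → p ⊗ q ≋ p′ ⊗ q′
  ⊗-cong {p} {p′} {q} {q′} e f =
    ≋-trans (⊗-congˡ p f)
    (≋-trans (⊗-comm p q′) (≋-trans (⊗-congˡ q′ e) (⊗-comm q′ p′)))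

  ⊗-distribʳ : ∀ p q r → (q ⊕ r) ⊗ p ≋ q ⊗ p ⊕ r ⊗ p
  ⊗-distribʳ p q r = ≋-trans (⊗-comm (q ⊕ r) p)
    (≋-trans (⊗-distribˡ p q r) (⊕-cong (⊗-comm p q) (⊗-comm p r)))

  ·-⊗ : ∀ a p q → a · (p ⊗ q) ≋ (a · p) ⊗ q
  ·-⊗ a []      q = ≋-refl
  ·-⊗ a (b ∷ p) q = ≋-trans (·-distribˡ a (b · q) (0# ∷ p ⊗ q))
    (⊕-cong (≋-sym (·-assoc a b q))
            (≋-trans (·-0∷ a (p ⊗ q)) (∷-cong ≈-refl (·-⊗ a p q))))

  0∷-⊗ : ∀ p q → (0# ∷ p) ⊗ q ≋ 0# ∷ p ⊗ q
  0∷-⊗ p q = ⊕-cong (·-zeroˡ ≈-refl q) ≋-refl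

  ⊗-assoc : ∀ p q r → (p ⊗ q) ⊗ r ≋ p ⊗ (q ⊗ r)
  ⊗-assoc []      q r = ≋-refl
  ⊗-assoc (a ∷ p) q r = ≋-trans (⊗-distribʳ r (a · q) (0# ∷ p ⊗ q))
    (⊕-cong (≋-sym (·-⊗ a q r))
            (≋-trans (0∷-⊗ (p ⊗ q) r) (∷-cong ≈-refl (⊗-assoc p q r))))

  ⊗-identityˡ : ∀ p → C 1# ⊗ p ≋ p
  ⊗-identityˡ p = ≋-trans (⊕-cong (·-identityˡ p) 0∷[]) (⊕-identityʳ p)

  polynomialRing : CommutativeRing c ℓ
  polynomialRing = record
    { Carrier = Poly
    ; _≈_     = _≋_
    ; _+_     = _⊕_
    ; _*_     = _⊗_
    ; -_      = ⊖_
    ; 0#      = []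
    ; 1#      = C 1#
    ; isCommutativeRing = record
      { isRing = record
        { +-isAbelianGroup = record
          { isGroup = record
            { isMonoid = record
              { isSemigroup = record
                { isMagma = record
                  { isEquivalence = record
                    { refl = ≋-refl ; sym = ≋-sym ; trans = ≋-trans }
                  ; ∙-cong = ⊕-cong
                  }
                ; assoc = ⊕-assoc
                }
              ; identity = (λ _ → ≋-refl) , ⊕-identityʳ
              }
            ; inverse = ⊖-inverseˡ , ⊖-inverseʳ
            ; ⁻¹-cong = ⊖-cong
            }
          ; comm = ⊕-comm
          }
        ; *-cong = ⊗-cong
        ; *-assoc = ⊗-assoc
        ; *-identity = ⊗-identityˡ ,
            λ p → ≋-trans (⊗-comm p (C 1#)) (⊗-identityˡ p)
        ; distrib = ⊗-distribˡ , ⊗-distribʳ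
        }
      ; *-comm = ⊗-comm
      }
    }

  ⊗-noZeroDivisors : ∀ p q → p ⊗ q ≋ [] → p ≋ [] ⊎ q ≋ []
  ⊗-noZeroDivisors []      q       e = inj₁ ≋-refl
  ⊗-noZeroDivisors (a ∷ p) []      e = inj₂ ≋-refl
  ⊗-noZeroDivisors (a ∷ p) (b ∷ q) e = [
    (λ a≈0 → Sum.map₁ (∷≋[] a≈0)
      (⊗-noZeroDivisors p (b ∷ q) (tail-≋[] (≋-trans
        (≋-sym (⊕-cong (·-zeroˡ a≈0 (b ∷ q)) ≋-refl)) e)))) ,
    (λ b≈0 → Sum.map₂ (∷≋[] b≈0)
      (⊗-noZeroDivisors (a ∷ p) q (tail-≋[] (≋-trans
        (≋-sym (≋-trans (⊗-∷ (a ∷ p) b q)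
          (⊕-cong (·-zeroˡ b≈0 (a ∷ p)) ≋-refl))) e)))) ]′
    (D.noZeroDivisors a b (trans (sym (+-identityʳ _)) (coeff-≈ e 0)))

  polynomialDomain : IntegralDomain c ℓ
  polynomialDomain = record
    { commutativeRing = polynomialRing
    ; 1≉0             = λ e → D.1≉0 (coeff-≈ e 0)
    ; noZeroDivisors  = ⊗-noZeroDivisors
    }

module FractionField (D : IntegralDomain c ℓ) where
  open IntegralDomain D hiding (1≉0; noZeroDivisors) renaming (refl to ≈-refl)
  private module D = IntegralDomain D
  open import Algebra.Properties.Ring ring
    using (-‿distribˡ-*; x∙y⁻¹≈ε⇒x≈y; x[y-z]≈xy-xz)
  open import Algebra.Properties.CommutativeSemigroup *-commutativeSemigroup
    using (interchange; xy∙z≈xz∙y)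
  open import Relation.Binary.Reasoning.Setoid setoid
  open import Algebra.Solver.Ring.NaturalCoefficients.Default
    commutativeSemiring using (solve; con; _:=_; _:+_; _:*_)

  infix  4 _≃_
  infixl 6 _+ᶠ_
  infixl 7 _*ᶠ_
  infix  9 _⁻¹⟨_⟩

  record Fraction : Set (c ⊔ ℓ) where
    constructor frac
    field
      num   : Carrier
      den   : Carrier
      den≉0 : ¬ den ≈ 0#
  open Fraction public

  record _≃_ (x y : Fraction) : Set ℓ where
    constructor mk≃
    field cross : num x * den y ≈ num y * den x
  open _≃_ public

  *-≉0 : ∀ {a b} → ¬ a ≈ 0# → ¬ b ≈ 0# → ¬ a * b ≈ 0#
  *-≉0 a≉0 b≉0 e with D.noZeroDivisors _ _ e
  ... | inj₁ a≈0 = a≉0 a≈0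
  ... | inj₂ b≈0 = b≉0 b≈0

  *-cancelˡ : ∀ {a b c} → ¬ a ≈ 0# → a * b ≈ a * c → b ≈ c
  *-cancelˡ {a} {b} {c} a≉0 e with D.noZeroDivisors a (b - c)
    (trans (x[y-z]≈xy-xz a b c) (trans (+-congʳ e) (-‿inverseʳ _)))
  ... | inj₁ a≈0   = ⊥-elim (a≉0 a≈0)
  ... | inj₂ b-c≈0 = x∙y⁻¹≈ε⇒x≈y b c b-c≈0

  ι : Carrier → Fraction
  ι a = frac a 1# D.1≉0

  _+ᶠ_ : Fraction → Fraction → Fraction
  frac a b b≉0 +ᶠ frac c d d≉0 = frac (a * d + c * b) (b * d) (*-≉0 b≉0 d≉0)

  _*ᶠ_ : Fraction → Fraction → Fraction
  frac a b b≉0 *ᶠ frac c d d≉0 = frac (a * c) (b * d) (*-≉0 b≉0 d≉0)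

  -ᶠ_ : Fraction → Fraction
  -ᶠ frac a b b≉0 = frac (- a) b b≉0

  0ᶠ 1ᶠ : Fraction
  0ᶠ = ι 0#
  1ᶠ = ι 1#

  ≃-refl : ∀ {x} → x ≃ x
  ≃-refl = mk≃ ≈-refl

  ≃-sym : ∀ {x y} → x ≃ y → y ≃ x
  ≃-sym (mk≃ e) = mk≃ (sym e)

  ≃-trans : ∀ {x y z} → x ≃ y → y ≃ z → x ≃ z
  ≃-trans {frac a b _} {frac c d d≉0} {frac e f _} (mk≃ p) (mk≃ q) =
    mk≃ (*-cancelˡ d≉0 (begin
      d * (a * f)  ≈⟨ solve 3 (λ a d f → d :* (a :* f) := (a :* d) :* f) ≈-refl a d f ⟩
      (a * d) * f  ≈⟨ *-congʳ p ⟩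
      (c * b) * f  ≈⟨ xy∙z≈xz∙y c b f ⟩
      (c * f) * b  ≈⟨ *-congʳ q ⟩
      (e * d) * b  ≈⟨ solve 3 (λ b d e → (e :* d) :* b := d :* (e :* b)) ≈-refl b d e ⟩
      d * (e * b)  ∎))

  +ᶠ-cong : ∀ {x x′ y y′} → x ≃ x′ → y ≃ y′ → x +ᶠ y ≃ x′ +ᶠ y′
  +ᶠ-cong {frac a b _} {frac a′ b′ _} {frac c d _} {frac c′ d′ _} (mk≃ p) (mk≃ q) =
    mk≃ (begin
      (a * d + c * b) * (b′ * d′)
        ≈⟨ solve 6 (λ a b c d b′ d′ → (a :* d :+ c :* b) :* (b′ :* d′) :=
             (a :* b′) :* (d :* d′) :+ (c :* d′) :* (b :* b′)) ≈-refl a b c d b′ d′ ⟩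
      (a * b′) * (d * d′) + (c * d′) * (b * b′)
        ≈⟨ +-cong (*-congʳ p) (*-congʳ q) ⟩
      (a′ * b) * (d * d′) + (c′ * d) * (b * b′)
        ≈⟨ solve 6 (λ a′ b c′ d b′ d′ →
             (a′ :* b) :* (d :* d′) :+ (c′ :* d) :* (b :* b′) :=
             (a′ :* d′ :+ c′ :* b′) :* (b :* d)) ≈-refl a′ b c′ d b′ d′ ⟩
      (a′ * d′ + c′ * b′) * (b * d) ∎)

  *ᶠ-cong : ∀ {x x′ y y′} → x ≃ x′ → y ≃ y′ → x *ᶠ y ≃ x′ *ᶠ y′
  *ᶠ-cong (mk≃ p) (mk≃ q) = mk≃ (trans (interchange _ _ _ _)
    (trans (*-cong p q) (interchange _ _ _ _)))

  -ᶠ-cong : ∀ {x y} → x ≃ y → -ᶠ x ≃ -ᶠ y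
  -ᶠ-cong (mk≃ p) = mk≃ (trans (sym (-‿distribˡ-* _ _))
    (trans (-‿cong p) (-‿distribˡ-* _ _)))

  +ᶠ-assoc : ∀ x y z → (x +ᶠ y) +ᶠ z ≃ x +ᶠ (y +ᶠ z)
  +ᶠ-assoc (frac a b _) (frac c d _) (frac e f _) = mk≃ (solve 6
    (λ a b c d e f →
      ((a :* d :+ c :* b) :* f :+ e :* (b :* d)) :* (b :* (d :* f)) :=
      (a :* (d :* f) :+ (c :* f :+ e :* d) :* b) :* ((b :* d) :* f))
    ≈-refl a b c d e f)

  +ᶠ-comm : ∀ x y → x +ᶠ y ≃ y +ᶠ x
  +ᶠ-comm (frac a b _) (frac c d _) = mk≃
    (*-cong (+-comm (a * d) (c * b)) (*-comm d b))

  +ᶠ-identityˡ : ∀ x → 0ᶠ +ᶠ x ≃ x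
  +ᶠ-identityˡ (frac a b _) = mk≃ (solve 2
    (λ a b → (con 0 :* b :+ a :* con 1) :* b := a :* (con 1 :* b)) ≈-refl a b)

  -ᶠ-inverseˡ : ∀ x → (-ᶠ x) +ᶠ x ≃ 0ᶠ
  -ᶠ-inverseˡ (frac a b _) = mk≃ (begin
    (- a * b + a * b) * 1#  ≈⟨ *-identityʳ _ ⟩
    - a * b + a * b         ≈⟨ distribʳ b (- a) a ⟨
    (- a + a) * b           ≈⟨ *-congʳ (-‿inverseˡ a) ⟩
    0# * b                  ≈⟨ zeroˡ b ⟩
    0#                      ≈⟨ zeroˡ (b * b) ⟨
    0# * (b * b)            ∎)

  *ᶠ-assoc : ∀ x y z → (x *ᶠ y) *ᶠ z ≃ x *ᶠ (y *ᶠ z)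
  *ᶠ-assoc x y z = mk≃ (*-cong (*-assoc _ _ _) (sym (*-assoc _ _ _)))

  *ᶠ-comm : ∀ x y → x *ᶠ y ≃ y *ᶠ x
  *ᶠ-comm x y = mk≃ (*-cong (*-comm _ _) (*-comm _ _))

  *ᶠ-identityˡ : ∀ x → 1ᶠ *ᶠ x ≃ x
  *ᶠ-identityˡ x = mk≃ (*-cong (*-identityˡ _) (sym (*-identityˡ _)))

  *ᶠ-distribˡ : ∀ x y z → x *ᶠ (y +ᶠ z) ≃ x *ᶠ y +ᶠ x *ᶠ z
  *ᶠ-distribˡ (frac a b _) (frac c d _) (frac e f _) = mk≃ (solve 6
    (λ a b c d e f →
      (a :* (c :* f :+ e :* d)) :* ((b :* d) :* (b :* f)) :=
      ((a :* c) :* (b :* f) :+ (a :* e) :* (b :* d)) :* (b :* (d :* f)))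
    ≈-refl a b c d e f)

  fractionField : CommutativeRing (c ⊔ ℓ) ℓ
  fractionField = record
    { Carrier = Fraction
    ; _≈_     = _≃_
    ; _+_     = _+ᶠ_
    ; _*_     = _*ᶠ_
    ; -_      = -ᶠ_
    ; 0#      = 0ᶠ
    ; 1#      = 1ᶠ
    ; isCommutativeRing = record
      { isRing = record
        { +-isAbelianGroup = record
          { isGroup = record
            { isMonoid = record
              { isSemigroup = record
                { isMagma = record
                  { isEquivalence = record
                    { refl = ≃-refl ; sym = ≃-sym ; trans = ≃-trans }
                  ; ∙-cong = +ᶠ-cong
                  }
                ; assoc = +ᶠ-assoc
                }
              ; identity = +ᶠ-identityˡ ,
                  λ x → ≃-trans (+ᶠ-comm x 0ᶠ) (+ᶠ-identityˡ x)
              }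
            ; inverse = -ᶠ-inverseˡ ,
                λ x → ≃-trans (+ᶠ-comm x (-ᶠ x)) (-ᶠ-inverseˡ x)
            ; ⁻¹-cong = -ᶠ-cong
            }
          ; comm = +ᶠ-comm
          }
        ; *-cong = *ᶠ-cong
        ; *-assoc = *ᶠ-assoc
        ; *-identity = *ᶠ-identityˡ ,
            λ x → ≃-trans (*ᶠ-comm x 1ᶠ) (*ᶠ-identityˡ x)
        ; distrib = *ᶠ-distribˡ , λ x y z →
            ≃-trans (*ᶠ-comm (y +ᶠ z) x) (≃-trans (*ᶠ-distribˡ x y z)
              (+ᶠ-cong (*ᶠ-comm x y) (*ᶠ-comm x z)))
        }
      ; *-comm = *ᶠ-comm
      }
    }

  num≉0 : ∀ {x} → ¬ x ≃ 0ᶠ → ¬ num x ≈ 0#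
  num≉0 {x} x≉0 e =
    x≉0 (mk≃ (trans (*-identityʳ _) (trans e (sym (zeroˡ (den x))))))

  _⁻¹⟨_⟩ : (x : Fraction) → ¬ x ≃ 0ᶠ → Fraction
  x ⁻¹⟨ x≉0 ⟩ = frac (den x) (num x) (num≉0 x≉0)

  ⁻¹-inverseˡ : ∀ x (x≉0 : ¬ x ≃ 0ᶠ) → x ⁻¹⟨ x≉0 ⟩ *ᶠ x ≃ 1ᶠ
  ⁻¹-inverseˡ x _ = mk≃ (trans (*-identityʳ _)
    (trans (*-comm _ _) (sym (*-identityˡ _))))

-- Rational functions in y and t: the field of fractions of ℤ[y][t],
-- which is ℚ(y,t)

module ℤ[y]    = Polynomial ℤ-domain
module ℤ[y][t] = Polynomial ℤ[y].polynomialDomain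

open FractionField ℤ[y][t].polynomialDomain public
  using (_⁻¹⟨_⟩; ⁻¹-inverseˡ; ι)

ℚ⟨y,t⟩ : CommutativeRing 0ℓ 0ℓ
ℚ⟨y,t⟩ = FractionField.fractionField ℤ[y][t].polynomialDomain

open CommutativeRing ℚ⟨y,t⟩ public
  using (Carrier; _≈_; _+_; _*_; -_; _-_; 0#; 1#)
open import Algebra.Properties.Semiring.Exp
  (CommutativeRing.semiring ℚ⟨y,t⟩) public using (_^_)
open import Algebra.Properties.Semiring.Mult
  (CommutativeRing.semiring ℚ⟨y,t⟩) public using (_×_)
open import Algebra.Properties.CommutativeMonoid.Sum
  (CommutativeRing.+-commutativeMonoid ℚ⟨y,t⟩) public using (sum⁺-syntax)
open DescentPolynomials ℚ⟨y,t⟩ public using (B; F)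

y t : Carrier
y = ι (ℤ[y][t].C ℤ[y].X)
t = ι ℤ[y][t].X

t≉0 : ¬ t ≈ 0#
t≉0 e with ℤ[y].coeff-≈ (ℤ[y][t].coeff-≈ (FractionField.cross e) 1) 0
... | ()

1+t≉0 : ¬ 1# + t ≈ 0#
1+t≉0 e with ℤ[y].coeff-≈ (ℤ[y][t].coeff-≈ (FractionField.cross e) 1) 0
... | ()

{-# OPTIONS --safe #-}

-- Removing the first letter of a signed word of length n + 1 and replacing the
-- other letters by their ranks leaves a signed word of length n; the removed
-- letter, of absolute rank r, then matters only through r.  Let W⁺ i n and W⁻ i n
-- be the generating functions of y^neg s^des over the signed words of length n
-- preceded by a positive, respectively negative, letter whose absolute value
-- exceeds exactly i of theirs.  Then, all sums being over 0 ≤ r ≤ n,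
--   W⁺ i (n + 1) = Σ s^[r < i] W⁺ r n + y s Σ W⁻ r n,
-- so that W⁺ satisfies Pascal's recurrence
--   W⁺ (i + 1) (n + 1) = W⁺ i (n + 1) + (s - 1) W⁺ i n.
-- Hence W⁺ n n = Σ_k C(n,k) (s - 1)^(n-k) W⁺ 0 k, where W⁺ 0 k = B_k(y,s).  With
-- P = Σ W⁺ r n and N = Σ W⁻ r n at s = t², the recurrence gives B_{n+1} = P + y t² N
-- and W⁺ (n + 1) (n + 1) = t² P + y t² N, while F_{n+1} = P + y t N.
module Submission where

open import Defs using (±[_]; value; pos; IsSignedPermutation; isSignedPermutation?; 𝔅; entry; desB; neg; fdes; module DescentPolynomials)
open import Algebra.Bundles using (CommutativeRing)
open import Data.Bool.Base using (Bool; true; false; if_then_else_)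
open import Data.Fin.Base as Fin using (Fin; zero; suc; toℕ; fromℕ; inject₁; opposite; punchIn; punchOut; finToFun; funToFin; splitAt; _↑ˡ_; _↑ʳ_)
import Data.Fin.Properties as Fin
open import Data.Integer.Base as ℤ using (ℤ; 0ℤ; +_; +[1+_]; -[1+_])
import Data.Integer.Properties as ℤ
open import Data.List.Base as List using (List; []; _∷_; _++_; allFin; cartesianProduct; cartesianProductWith; foldr)
open import Data.List.Membership.Propositional using (_∈_)
open import Data.List.Membership.Propositional.Properties using (∈-allFin; ∈-cartesianProduct⁺; ∈-cartesianProductWith⁺; ∈-cartesianProductWith⁻; ∈-filter⁺; ∈-filter⁻; ∈-map⁺; ∈-map⁻)
open import Data.List.Membership.Propositional.Properties.WithK using (unique∧set⇒bag)
import Data.List.Properties as List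
open import Data.List.Relation.Binary.BagAndSetEquality using (∼bag⇒↭)
open import Data.List.Relation.Binary.Permutation.Propositional as Perm using (_↭_)
open import Data.List.Relation.Unary.All as All using (All; []; _∷_)
import Data.List.Relation.Unary.All.Properties as All
open import Data.List.Relation.Unary.AllPairs as AllPairs using (AllPairs; []; _∷_)
import Data.List.Relation.Unary.AllPairs.Properties as AllPairs
open import Data.List.Relation.Unary.Any using (here; there)
open import Data.List.Relation.Unary.Unique.Propositional using (Unique)
import Data.List.Relation.Unary.Unique.Propositional.Properties as Unique
open import Data.Maybe.Base as Maybe using (Maybe; just; nothing)
import Data.Maybe.Properties as Maybe
open import Data.Nat.Base as ℕ using (ℕ; zero; suc; _∸_; _<ᵇ_; NonZero)
open import Data.Nat.Combinatorics using (_C_; nCk+nC[k+1]≡[n+1]C[k+1]; k>n⇒nCk≡0)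
import Data.Nat.Properties as ℕ
open import Data.Product.Base as Product using (∃; _,_; proj₁; proj₂; map₁; map₂)
open import Data.Sign.Base as Sign using (Sign)
import Data.Sign.Properties as Sign
open import Data.Sum.Base using (inj₁; inj₂)
open import Data.Vec.Base as Vec using (Vec; []; _∷_; lookup; tabulate)
import Data.Vec.Properties as Vec
open import Function.Base using (id; _∘_)
open import Function.Bundles using (mk⇔)
open import Function.Definitions using (Injective; Surjective)
open import Level using (Level)
open import Relation.Binary.Core using (Rel)
open import Relation.Binary.PropositionalEquality as ≡ using (_≡_; _≢_; _≗_; refl; sym; trans; cong; cong₂; subst; module ≡-Reasoning)
open import Relation.Nullary using (does; yes; no; contradiction)
open import Relation.Nullary.Decidable using (dec-true)
open import Relation.Unary using (Pred; Decidable)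

private variable
  a b p ℓ : Level
  m n k : ℕ

-- Counting, injections of finite sets and pairwise relations on lists

count-tabulate : ∀ {A : Set a} {P : Pred A p} (P? : Decidable P) (f : Fin n → A) →
  Vec.count P? (tabulate f) ≡ Vec.count (P? ∘ f) (Vec.allFin n)
count-tabulate {n = zero}  P? f = refl
count-tabulate {n = suc n} P? f = cong (if does (P? (f zero)) then suc else id)
  (trans (count-tabulate P? (f ∘ suc)) (sym (count-tabulate (P? ∘ f) suc)))

-- Pigeonhole: if j were missed, punching j out of the codomain would inject `Fin (suc n)` into
-- `Fin n`.
injective⇒surjective : ∀ {f : Fin n → Fin n} → Injective _≡_ _≡_ f → Surjective _≡_ _≡_ f
injective⇒surjective {n = suc n} {f} inj j with Fin.any? (λ i → f i Fin.≟ j)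
... | yes (i , fi≡j) = i , λ { refl → fi≡j }
... | no  ∄i = contradiction
  (Fin.injective⇒≤ λ {x} {y} → inj ∘ Fin.punchOut-injective (j≢f x) (j≢f y)) ℕ.1+n≰n
  where
  j≢f : ∀ i → j ≢ f i
  j≢f i j≡fi = ∄i (i , sym j≡fi)

-- Needed because functions that differ are known to have different words only when both are signed
-- permutations.
AllPairs-map-All : ∀ {A : Set a} {P : Pred A p} {R S : Rel A ℓ} →
  (∀ {x y} → P x → P y → R x y → S x y) →
  ∀ {xs} → All P xs → AllPairs R xs → AllPairs S xs
AllPairs-map-All f []         []         = []
AllPairs-map-All f (px ∷ pxs) (rx ∷ rxs) =
  All.zipWith (λ (py , rxy) → f px py rxy) (pxs , rx) ∷ AllPairs-map-All f pxs rxs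

-- Signed words

Letter : ℕ → Set
Letter n = Fin n Product.× Sign

letters : ∀ n → List (Letter n)
letters n = cartesianProduct (allFin n) (Sign.+ ∷ Sign.- ∷ [])

⟦_⟧ : Letter n → ℤ
⟦ a , Sign.+ ⟧ = +[1+ toℕ a ]
⟦ a , Sign.- ⟧ = -[1+ toℕ a ]

⟦⟧-injective : ∀ {k l : Letter n} → ⟦ k ⟧ ≡ ⟦ l ⟧ → k ≡ l
⟦⟧-injective {k = _ , Sign.+} {_ , Sign.+} e =
  cong (_, _) (Fin.toℕ-injective (ℕ.suc-injective (ℤ.+-injective e)))
⟦⟧-injective {k = _ , Sign.-} {_ , Sign.-} e =
  cong (_, _) (Fin.toℕ-injective (ℤ.-[1+-injective e))
⟦⟧-injective {k = _ , Sign.+} {_ , Sign.-} ()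
⟦⟧-injective {k = _ , Sign.-} {_ , Sign.+} ()

shift : Fin (suc n) → Letter n → Letter (suc n)
shift r = map₁ (punchIn r)

-- The remaining letters are recorded by their ranks once the first one is removed.

_◂_ : Letter (suc n) → Vec (Letter n) k → Vec (Letter (suc n)) (suc k)
l ◂ w = l ∷ Vec.map (shift (proj₁ l)) w

words : ∀ n → List (Vec (Letter n) n)
words zero    = [] ∷ []
words (suc n) = cartesianProductWith _◂_ (letters (suc n)) (words n)

shift-injective : ∀ (r : Fin (suc n)) {k l} → shift r k ≡ shift r l → k ≡ l
shift-injective r e =
  cong₂ _,_ (Fin.punchIn-injective r _ _ (cong proj₁ e)) (cong proj₂ e)

map-injective : ∀ {A : Set a} {B : Set b} {f : A → B} →
  (∀ {x y} → f x ≡ f y → x ≡ y) → {v w : Vec A n} → Vec.map f v ≡ Vec.map f w → v ≡ w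
map-injective inj {[]}    {[]}    e = refl
map-injective inj {x ∷ v} {y ∷ w} e =
  cong₂ _∷_ (inj (Vec.∷-injectiveˡ e)) (map-injective inj (Vec.∷-injectiveʳ e))

tabulate-injective : ∀ {A : Set a} {f g : Fin n → A} → tabulate f ≡ tabulate g → f ≗ g
tabulate-injective {f = f} {g} e i = trans (sym (Vec.lookup∘tabulate f i))
  (trans (cong (λ v → lookup v i) e) (Vec.lookup∘tabulate g i))

letters-unique : ∀ n → Unique (letters n)
letters-unique n = Unique.cartesianProduct⁺ (Unique.allFin⁺ n) (((λ ()) ∷ []) ∷ [] ∷ [])

∈-letters : (l : Letter n) → l ∈ letters n
∈-letters (a , Sign.+) = ∈-cartesianProduct⁺ (∈-allFin a) (here refl)
∈-letters (a , Sign.-) = ∈-cartesianProduct⁺ (∈-allFin a) (there (here refl))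

◂-injective : ∀ {k l : Letter (suc n)} {v w : Vec (Letter n) m} →
  k ◂ v ≡ l ◂ w → k ≡ l Product.× v ≡ w
◂-injective e with refl ← Vec.∷-injectiveˡ e =
  refl , map-injective (shift-injective _) (Vec.∷-injectiveʳ e)

words-unique : ∀ n → Unique (words n)
words-unique zero    = [] ∷ []
words-unique (suc n) =
  Unique.cartesianProductWith⁺ _◂_ ◂-injective (letters-unique (suc n)) (words-unique n)

-- It is the absolute values that must differ: a signed permutation cannot contain both a letter and
-- its negative.
Distinct : Vec (Letter n) k → Set
Distinct w = ∀ {i j} → proj₁ (lookup w i) ≡ proj₁ (lookup w j) → i ≡ j

∈-words⇒distinct : ∀ {w} → w ∈ words n → Distinct w
∈-words⇒distinct {n = zero}  w∈ {()}
∈-words⇒distinct {n = suc n} w∈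
  with (r , s) , v , _ , v∈ , refl ← ∈-cartesianProductWith⁻ _◂_ (letters (suc n)) (words n) w∈
  = distinct
  where
  absᵢ : ∀ i → proj₁ (lookup (Vec.map (shift r) v) i) ≡ punchIn r (proj₁ (lookup v i))
  absᵢ i = cong proj₁ (Vec.lookup-map i (shift r) v)

  distinct : Distinct ((r , s) ◂ v)
  distinct {zero}  {zero}  e = refl
  distinct {zero}  {suc j} e = contradiction (sym (trans e (absᵢ j))) (Fin.punchInᵢ≢i r _)
  distinct {suc i} {zero}  e = contradiction (trans (sym (absᵢ i)) e) (Fin.punchInᵢ≢i r _)
  distinct {suc i} {suc j} e = cong suc (∈-words⇒distinct v∈
    (Fin.punchIn-injective r _ _ (trans (sym (absᵢ i)) (trans e (absᵢ j)))))

-- No later letter shares the absolute value r of the first, so r can be punched out of all of them;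
-- the resulting ranks are again distinct, and induction applies.
distinct⇒∈-words : (w : Vec (Letter n) n) → Distinct w → w ∈ words n
distinct⇒∈-words []            d = here refl
distinct⇒∈-words {n = suc n} ((r , s) ∷ w) d =
  subst (_∈ words (suc n)) (cong ((r , s) ∷_) map-shift)
    (∈-cartesianProductWith⁺ _◂_ (∈-letters (r , s)) (distinct⇒∈-words v v-distinct))
  where
  r≢ : ∀ i → r ≢ proj₁ (lookup w i)
  r≢ i e with () ← d {zero} {suc i} e

  rank : Fin n → Letter n
  rank i = punchOut (r≢ i) , proj₂ (lookup w i)

  v : Vec (Letter n) n
  v = tabulate rank

  v-distinct : Distinct v
  v-distinct {i} {j} e = Fin.suc-injective (d {suc i} {suc j}
    (Fin.punchOut-injective (r≢ i) (r≢ j) (trans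
      (sym (cong proj₁ (Vec.lookup∘tabulate rank i)))
      (trans e (cong proj₁ (Vec.lookup∘tabulate rank j))))))

  map-shift : Vec.map (shift r) v ≡ w
  map-shift = trans (sym (Vec.tabulate-∘ (shift r) rank)) (trans
    (Vec.tabulate-cong λ i → cong (_, proj₂ (lookup w i)) (Fin.punchIn-punchOut (r≢ i)))
    (Vec.tabulate∘lookup w))

-- Statistics of words

-- `p` stands directly before the word: it is 0 for a whole signed permutation, and a removed letter
-- or its `gap` in the recursions.
desAfter : ℤ → Vec ℤ k → ℕ
desAfter p []      = 0
desAfter p (x ∷ v) = (if does (x ℤ.<? p) then suc else id) (desAfter x v)

negs : Vec ℤ k → ℕ
negs []      = 0
negs (x ∷ v) = (if does (x ℤ.<? 0ℤ) then suc else id) (negs v)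

fdesᵥ : Vec ℤ (suc k) → ℕ
fdesᵥ v@(x ∷ _) =
  if does (x ℤ.<? 0ℤ) then 2 ℕ.* desAfter 0ℤ v ∸ 1 else 2 ℕ.* desAfter 0ℤ v

punchIn-<ᵇ : ∀ (r : Fin (suc n)) a → (toℕ (punchIn r a) <ᵇ toℕ r) ≡ (toℕ a <ᵇ toℕ r)
punchIn-<ᵇ zero    a       = refl
punchIn-<ᵇ (suc r) zero    = refl
punchIn-<ᵇ (suc r) (suc a) = punchIn-<ᵇ r a

-- `punchIn r` fixes the ranks below r and raises the others by one, so being above r afterwards
-- means being at least r before; hence the `suc` on the right.
<ᵇ-punchIn : ∀ (r : Fin (suc n)) a → (toℕ r <ᵇ toℕ (punchIn r a)) ≡ (toℕ r <ᵇ suc (toℕ a))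
<ᵇ-punchIn zero    a       = refl
<ᵇ-punchIn (suc r) zero    = refl
<ᵇ-punchIn (suc r) (suc a) = <ᵇ-punchIn r a

punchIn-mono-<ᵇ : ∀ (r : Fin (suc n)) a b →
  (toℕ (punchIn r a) <ᵇ toℕ (punchIn r b)) ≡ (toℕ a <ᵇ toℕ b)
punchIn-mono-<ᵇ zero    a       b       = refl
punchIn-mono-<ᵇ (suc r) zero    zero    = refl
punchIn-mono-<ᵇ (suc r) zero    (suc b) = refl
punchIn-mono-<ᵇ (suc r) (suc a) zero    = refl
punchIn-mono-<ᵇ (suc r) (suc a) (suc b) = punchIn-mono-<ᵇ r a b

shift-mono : ∀ (r : Fin (suc n)) k l →
  does (⟦ shift r k ⟧ ℤ.<? ⟦ shift r l ⟧) ≡ does (⟦ k ⟧ ℤ.<? ⟦ l ⟧)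
shift-mono r (a , Sign.+) (b , Sign.+) = punchIn-mono-<ᵇ r a b
shift-mono r (a , Sign.+) (b , Sign.-) = refl
shift-mono r (a , Sign.-) (b , Sign.+) = refl
shift-mono r (a , Sign.-) (b , Sign.-) = punchIn-mono-<ᵇ r b a

-- Once the letter l is removed and the others are replaced by their ranks, a
-- letter was below l exactly if its rank is now below gap l.

gap : Letter n → ℤ
gap (r , Sign.+) = +[1+ toℕ r ]
gap (r , Sign.-) = ℤ.- (+ toℕ r)

shift-<-gap : ∀ (l : Letter (suc n)) k →
  does (⟦ shift (proj₁ l) k ⟧ ℤ.<? ⟦ l ⟧) ≡ does (⟦ k ⟧ ℤ.<? gap l)
shift-<-gap (r     , Sign.+) (a , Sign.+) = punchIn-<ᵇ r a
shift-<-gap (r     , Sign.+) (a , Sign.-) = refl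
shift-<-gap (zero  , Sign.-) (a , Sign.+) = refl
shift-<-gap (suc r , Sign.-) (a , Sign.+) = refl
-- A negative letter of rank a was below the removed one exactly if a ≥ r, that is, -(a + 1) < -r.
-- This is why the gap of a negative letter is -r and not -(r + 1).
shift-<-gap (zero  , Sign.-) (a , Sign.-) = refl
shift-<-gap (suc r , Sign.-) (a , Sign.-) = <ᵇ-punchIn (suc r) a

step-cong : ∀ {b c} {i j : ℕ} → b ≡ c → i ≡ j →
  (if b then suc else id) i ≡ (if c then suc else id) j
step-cong = cong₂ (λ b → if b then suc else id)

desAfter-shift : ∀ (r : Fin (suc n)) l (w : Vec (Letter n) k) →
  desAfter ⟦ shift r l ⟧ (Vec.map ⟦_⟧ (Vec.map (shift r) w)) ≡ desAfter ⟦ l ⟧ (Vec.map ⟦_⟧ w)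
desAfter-shift r l []      = refl
desAfter-shift r l (k ∷ w) = step-cong (shift-mono r k l) (desAfter-shift r k w)

-- Passing to ranks keeps the order among the remaining letters, so only the comparison of the
-- second letter with `l` has to be translated, and `gap l` does this.
desAfter-◂ : ∀ p (l : Letter (suc n)) (w : Vec (Letter n) k) →
  desAfter p (Vec.map ⟦_⟧ (l ◂ w)) ≡
  (if does (⟦ l ⟧ ℤ.<? p) then suc else id) (desAfter (gap l) (Vec.map ⟦_⟧ w))
desAfter-◂ p l []      = refl
desAfter-◂ p l (k ∷ w) = cong (if does (⟦ l ⟧ ℤ.<? p) then suc else id)
  (step-cong (shift-<-gap l k) (desAfter-shift (proj₁ l) k w))

negs-shift : ∀ (r : Fin (suc n)) (w : Vec (Letter n) k) →
  negs (Vec.map ⟦_⟧ (Vec.map (shift r) w)) ≡ negs (Vec.map ⟦_⟧ w)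
negs-shift r []                = refl
negs-shift r ((_ , Sign.+) ∷ w) = negs-shift r w
negs-shift r ((_ , Sign.-) ∷ w) = cong suc (negs-shift r w)

-- Signed permutations and their words

word : ∀ n → (±[ n ] → ±[ n ]) → Vec ℤ n
word n π = tabulate (entry n π ∘ suc)

-- Stated for an arbitrary sequence so that induction can pass to `e ∘ suc`, where `e (suc zero)`
-- takes over the role of the preceding entry.
count-descents : (e : Fin (suc n) → ℤ) →
  Vec.count (λ i → e (suc i) ℤ.<? e (inject₁ i)) (Vec.allFin n) ≡
  desAfter (e zero) (tabulate (e ∘ suc))
count-descents {n = zero}  e = refl
count-descents {n = suc n} e = cong (if does (e (suc zero) ℤ.<? e zero) then suc else id)
  (trans (count-tabulate (λ i → e (suc i) ℤ.<? e (inject₁ i)) suc) (count-descents (e ∘ suc)))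

count-negatives : (e : Fin n → ℤ) →
  Vec.count (λ i → e i ℤ.<? 0ℤ) (Vec.allFin n) ≡ negs (tabulate e)
count-negatives {n = zero}  e = refl
count-negatives {n = suc n} e = cong (if does (e zero ℤ.<? 0ℤ) then suc else id)
  (trans (count-tabulate (λ i → e i ℤ.<? 0ℤ) suc) (count-negatives (e ∘ suc)))

neg-word : ∀ (π : ±[ n ] → ±[ n ]) → neg n π ≡ negs (word n π)
neg-word {n} π = count-negatives (entry n π ∘ suc)

flip : Letter n → Letter n
flip = map₂ Sign.opposite

-- `nothing` is 0. The lowest n elements are -n,...,-1 in increasing order, so absolute values run
-- backwards there, whence `opposite a`.
encode : Maybe (Letter n) → ±[ n ]
encode {n} nothing             = pos n zero
encode {n} (just (a , Sign.+)) = pos n (suc a)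
encode {n} (just (a , Sign.-)) = opposite a ↑ˡ suc n

decode : ±[ n ] → Maybe (Letter n)
decode {n} k with splitAt n k
... | inj₁ a       = just (opposite a , Sign.-)
... | inj₂ zero    = nothing
... | inj₂ (suc a) = just (a , Sign.+)

decode-encode : (m : Maybe (Letter n)) → decode (encode m) ≡ m
decode-encode {n} nothing             rewrite Fin.splitAt-↑ʳ n (suc n) zero    = refl
decode-encode {n} (just (a , Sign.+)) rewrite Fin.splitAt-↑ʳ n (suc n) (suc a) = refl
decode-encode {n} (just (a , Sign.-)) rewrite Fin.splitAt-↑ˡ n (opposite a) (suc n) =
  cong (λ a → just (a , Sign.-)) (Fin.opposite-involutive a)

encode-decode : (k : ±[ n ]) → encode (decode k) ≡ k
encode-decode {n} k with splitAt n k in eq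
... | inj₁ a       = trans (cong (_↑ˡ suc n) (Fin.opposite-involutive a)) (Fin.splitAt⁻¹-↑ˡ eq)
... | inj₂ zero    = Fin.splitAt⁻¹-↑ʳ eq
... | inj₂ (suc a) = Fin.splitAt⁻¹-↑ʳ eq

encode-injective : {m o : Maybe (Letter n)} → encode m ≡ encode o → m ≡ o
encode-injective {m = m} {o} e =
  trans (sym (decode-encode m)) (trans (cong decode e) (decode-encode o))

decode-injective : {j k : ±[ n ]} → decode j ≡ decode k → j ≡ k
decode-injective {j = j} {k} e =
  trans (sym (encode-decode j)) (trans (cong encode e) (encode-decode k))

toℕ-opposite-pos : (i : Fin (suc n)) → toℕ (opposite (pos n i)) ≡ n ∸ toℕ i
toℕ-opposite-pos {n} i = begin
  toℕ (opposite (pos n i))              ≡⟨ Fin.opposite-prop (pos n i) ⟩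
  (n ℕ.+ suc n) ∸ suc (toℕ (pos n i))   ≡⟨ cong₂ _∸_ (ℕ.+-suc n n) (cong suc (Fin.toℕ-↑ʳ n i)) ⟩
  (n ℕ.+ n) ∸ (n ℕ.+ toℕ i)             ≡⟨ ℕ.[m+n]∸[m+o]≡n∸o n n (toℕ i) ⟩
  n ∸ toℕ i                             ∎
  where open ≡-Reasoning

opposite-encode : (m : Maybe (Letter n)) → opposite (encode m) ≡ encode (Maybe.map flip m)
opposite-encode {n} nothing = Fin.toℕ-injective (trans (toℕ-opposite-pos {n} zero)
  (sym (trans (Fin.toℕ-↑ʳ n zero) (ℕ.+-identityʳ n))))
opposite-encode {n} (just (a , Sign.+)) = Fin.toℕ-injective (trans (toℕ-opposite-pos (suc a))
  (sym (trans (Fin.toℕ-↑ˡ (opposite a) (suc n)) (Fin.opposite-prop a))))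
opposite-encode (just (a , Sign.-)) =
  trans (cong opposite (sym (opposite-encode (just (a , Sign.+))))) (Fin.opposite-involutive _)

value-zero : ∀ n → value n (pos n zero) ≡ 0ℤ
value-zero n = trans (cong (ℤ._⊖ n) (trans (Fin.toℕ-↑ʳ n zero) (ℕ.+-identityʳ n))) (ℤ.n⊖n≡0 n)

value-encode : (l : Letter n) → value n (encode (just l)) ≡ ⟦ l ⟧
value-encode {n} (a , Sign.+) = begin
  toℕ (pos n (suc a)) ℤ.⊖ n          ≡⟨ cong (ℤ._⊖ n) (Fin.toℕ-↑ʳ n (suc a)) ⟩
  (n ℕ.+ suc (toℕ a)) ℤ.⊖ n          ≡⟨ ℤ.⊖-≥ (ℕ.m≤m+n n _) ⟩
  + (n ℕ.+ suc (toℕ a) ∸ n)          ≡⟨ cong +_ (ℕ.m+n∸m≡n n _) ⟩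
  +[1+ toℕ a ]                       ∎
  where open ≡-Reasoning
value-encode {n} (a , Sign.-) = begin
  toℕ (opposite a ↑ˡ suc n) ℤ.⊖ n    ≡⟨ cong (ℤ._⊖ n) (Fin.toℕ-↑ˡ (opposite a) (suc n)) ⟩
  toℕ (opposite a) ℤ.⊖ n             ≡⟨ ℤ.⊖-< (Fin.toℕ<n (opposite a)) ⟩
  ℤ.- (+ (n ∸ toℕ (opposite a)))     ≡⟨ cong (λ k → ℤ.- (+ (n ∸ k))) (Fin.opposite-prop a) ⟩
  ℤ.- (+ (n ∸ (n ∸ suc (toℕ a))))    ≡⟨ cong (λ k → ℤ.- (+ k)) (ℕ.m∸[m∸n]≡n (Fin.toℕ<n a)) ⟩
  -[1+ toℕ a ]                       ∎
  where open ≡-Reasoning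

-- From a signed permutation to its word

module SignedPermutation {π : ±[ n ] → ±[ n ]} (π-signed : IsSignedPermutation π) where
  open IsSignedPermutation π-signed

  -- Oddness at 0 makes π 0 its own negative, while a nonzero letter and its negative differ in
  -- sign.
  π-zero : π (encode nothing) ≡ encode nothing
  π-zero with decode (π (encode nothing)) in eq
  ... | nothing = decode-injective (trans eq (sym (decode-encode nothing)))
  ... | just (a , s) = contradiction
    (cong proj₂ (Maybe.just-injective (encode-injective (begin
      encode (just (a , s))               ≡⟨ π0≡ ⟨
      π (encode nothing)                  ≡⟨ cong π (opposite-encode nothing) ⟨
      π (opposite (encode nothing))       ≡⟨ odd (encode nothing) ⟩
      opposite (π (encode nothing))       ≡⟨ cong opposite π0≡ ⟩
      opposite (encode (just (a , s)))    ≡⟨ opposite-encode (just (a , s)) ⟩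
      encode (just (flip (a , s)))        ∎))))
    (Sign.s≢opposite[s] s)
    where
    open ≡-Reasoning
    π0≡ : π (encode nothing) ≡ encode (just (a , s))
    π0≡ = trans (sym (encode-decode _)) (cong encode eq)

  -- The value 0 is already taken at position 0, so injectivity leaves a nonzero letter here.
  image : ∀ i → ∃ λ l → π (pos n (suc i)) ≡ encode (just l)
  image i with decode (π (pos n (suc i))) in eq
  ... | just l  = l , trans (sym (encode-decode _)) (cong encode eq)
  ... | nothing with () ← Fin.↑ʳ-injective n _ _ (proj₁ bijective
    (trans (trans (sym (encode-decode _)) (cong encode eq)) (sym π-zero)))

  letter : Fin n → Letter n
  letter i = proj₁ (image i)

  -- With equal signs this is injectivity. With opposite signs, oddness gives π i = π (-j) for the
  -- positive positions i and j, and injectivity would identify a positive position with a negative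
  -- one.
  letter-distinct : ∀ {i j} → proj₁ (letter i) ≡ proj₁ (letter j) → i ≡ j
  letter-distinct {i} {j} e with image i | image j
  letter-distinct {i} {j} refl | (a , s) , πi | (a , s′) , πj with s Sign.≟ s′
  ... | yes refl = Fin.suc-injective (Fin.↑ʳ-injective n _ _
    (proj₁ bijective (trans πi (sym πj))))
  ... | no s≢s′ = contradiction
    (encode-injective {m = just (i , Sign.+)} {just (j , Sign.-)} (proj₁ bijective (begin
      π (pos n (suc i))              ≡⟨ πi ⟩
      encode (just (a , s))          ≡⟨ cong (λ s → encode (just (a , s))) (≢⇒opposite s s′ s≢s′) ⟩
      encode (just (flip (a , s′)))  ≡⟨ opposite-encode (just (a , s′)) ⟨
      opposite (encode (just (a , s′)))  ≡⟨ cong opposite πj ⟨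
      opposite (π (pos n (suc j)))   ≡⟨ odd _ ⟨
      π (opposite (pos n (suc j)))   ≡⟨ cong π (opposite-encode (just (j , Sign.+))) ⟩
      π (encode (just (j , Sign.-))) ∎)))
    (λ ())
    where
    open ≡-Reasoning
    ≢⇒opposite : ∀ s s′ → s ≢ s′ → s ≡ Sign.opposite s′
    ≢⇒opposite Sign.+ Sign.+ s≢s = contradiction refl s≢s
    ≢⇒opposite Sign.+ Sign.- _   = refl
    ≢⇒opposite Sign.- Sign.+ _   = refl
    ≢⇒opposite Sign.- Sign.- s≢s = contradiction refl s≢s

  entry-letter : ∀ i → entry n π (suc i) ≡ ⟦ letter i ⟧
  entry-letter i = trans (cong (value n) (proj₂ (image i))) (value-encode (letter i))

  entry-zero : entry n π zero ≡ 0ℤ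
  entry-zero = trans (cong (value n) π-zero) (value-zero n)

  word∈ : word n π ∈ List.map (Vec.map ⟦_⟧) (words n)
  word∈ = subst (_∈ List.map (Vec.map ⟦_⟧) (words n))
    (trans (sym (Vec.tabulate-∘ ⟦_⟧ letter)) (Vec.tabulate-cong (sym ∘ entry-letter)))
    (∈-map⁺ (Vec.map ⟦_⟧) (distinct⇒∈-words (tabulate letter) λ {i} {j} e → letter-distinct
      (trans (cong proj₁ (sym (Vec.lookup∘tabulate letter i)))
        (trans e (cong proj₁ (Vec.lookup∘tabulate letter j))))))

  desB-word : desB n π ≡ desAfter 0ℤ (word n π)
  desB-word = trans (count-descents (entry n π)) (cong (λ p → desAfter p (word n π)) entry-zero)

fdes-word : ∀ {π : ±[ suc n ] → ±[ suc n ]} → IsSignedPermutation {suc n} π →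
  fdes (suc n) π ≡ fdesᵥ (word (suc n) π)
fdes-word {n} {π} π-signed = cong
  (λ d → if does (entry (suc n) π (suc zero) ℤ.<? 0ℤ) then 2 ℕ.* d ∸ 1 else 2 ℕ.* d)
  (SignedPermutation.desB-word {n = suc n} π-signed)

-- The word fixes the values at the positive positions; the value at 0 is forced, and oddness gives
-- the negative positions.
word-injective : ∀ {π σ : ±[ n ] → ±[ n ]} → IsSignedPermutation π → IsSignedPermutation σ →
  word n π ≡ word n σ → π ≗ σ
word-injective {n} {π} {σ} π-signed σ-signed e k =
  subst (λ k → π k ≡ σ k) (encode-decode k) (agree (decode k))
  where
  module π = SignedPermutation π-signed
  module σ = SignedPermutation σ-signed

  letter-≡ : ∀ i → π.letter i ≡ σ.letter i
  letter-≡ i = ⟦⟧-injective (trans (sym (π.entry-letter i))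
    (trans (tabulate-injective e i) (σ.entry-letter i)))

  agree⁺ : ∀ i → π (pos n (suc i)) ≡ σ (pos n (suc i))
  agree⁺ i = trans (proj₂ (π.image i))
    (trans (cong (encode ∘ just) (letter-≡ i)) (sym (proj₂ (σ.image i))))

  agree : ∀ m → π (encode m) ≡ σ (encode m)
  agree nothing             = trans π.π-zero (sym σ.π-zero)
  agree (just (i , Sign.+)) = agree⁺ i
  agree (just (i , Sign.-)) = begin
    π (encode (just (i , Sign.-)))  ≡⟨ cong π (opposite-encode (just (i , Sign.+))) ⟨
    π (opposite (pos n (suc i)))    ≡⟨ IsSignedPermutation.odd π-signed _ ⟩
    opposite (π (pos n (suc i)))    ≡⟨ cong opposite (agree⁺ i) ⟩
    opposite (σ (pos n (suc i)))    ≡⟨ IsSignedPermutation.odd σ-signed _ ⟨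
    σ (opposite (pos n (suc i)))    ≡⟨ cong σ (opposite-encode (just (i , Sign.+))) ⟩
    σ (encode (just (i , Sign.-)))  ∎
    where open ≡-Reasoning

-- From a word to a signed permutation

module FromWord (w : Vec (Letter n) n) (w-distinct : Distinct w) where

  -- The odd extension of the word: multiplying by the sign of the position makes the map commute
  -- with negation.
  act : Letter n → Letter n
  act (i , s) = map₂ (Sign._* s) (lookup w i)

  act-flip : ∀ l → act (flip l) ≡ flip (act l)
  act-flip (i , s) = cong (proj₁ (lookup w i) ,_) (*-opposite (proj₂ (lookup w i)) s)
    where
    *-opposite : ∀ s t → s Sign.* Sign.opposite t ≡ Sign.opposite (s Sign.* t)
    *-opposite Sign.+ t      = refl
    *-opposite Sign.- Sign.+ = refl
    *-opposite Sign.- Sign.- = refl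

  act-injective : ∀ {k l} → act k ≡ act l → k ≡ l
  act-injective {i , s} {j , s′} e with refl ← w-distinct {i} {j} (cong proj₁ e) =
    cong (i ,_) (Sign.*-cancelˡ-≡ (proj₂ (lookup w i)) s s′ (cong proj₂ e))

  permutation : ±[ n ] → ±[ n ]
  permutation k = encode (Maybe.map act (decode k))

  permutation-injective : Injective _≡_ _≡_ permutation
  permutation-injective {j} {k} e = decode-injective
    (Maybe.map-injective act-injective (encode-injective e))

  permutation-odd : ∀ k → permutation (opposite k) ≡ opposite (permutation k)
  permutation-odd k = begin
    encode (Maybe.map act (decode (opposite k)))
      ≡⟨ cong (encode ∘ Maybe.map act) decode-opposite ⟩
    encode (Maybe.map act (Maybe.map flip (decode k)))
      ≡⟨ cong encode (map-act-flip (decode k)) ⟩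
    encode (Maybe.map flip (Maybe.map act (decode k)))
      ≡⟨ opposite-encode (Maybe.map act (decode k)) ⟨
    opposite (encode (Maybe.map act (decode k)))
      ∎
    where
    open ≡-Reasoning
    decode-opposite : decode (opposite k) ≡ Maybe.map flip (decode k)
    decode-opposite = trans
      (cong decode (trans (cong opposite (sym (encode-decode k))) (opposite-encode (decode k))))
      (decode-encode _)

    map-act-flip : ∀ m → Maybe.map act (Maybe.map flip m) ≡ Maybe.map flip (Maybe.map act m)
    map-act-flip nothing  = refl
    map-act-flip (just l) = cong just (act-flip l)

  permutation-signed : IsSignedPermutation permutation
  permutation-signed = record
    { bijective = permutation-injective , injective⇒surjective permutation-injective
    ; odd       = permutation-odd
    }

  word-permutation : word n permutation ≡ Vec.map ⟦_⟧ w
  word-permutation = begin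
    tabulate (entry n permutation ∘ suc)  ≡⟨ Vec.tabulate-cong entry-lookup ⟩
    tabulate (⟦_⟧ ∘ lookup w)             ≡⟨ Vec.tabulate-∘ ⟦_⟧ (lookup w) ⟩
    Vec.map ⟦_⟧ (tabulate (lookup w))     ≡⟨ cong (Vec.map ⟦_⟧) (Vec.tabulate∘lookup w) ⟩
    Vec.map ⟦_⟧ w                         ∎
    where
    open ≡-Reasoning
    entry-lookup : ∀ i → entry n permutation (suc i) ≡ ⟦ lookup w i ⟧
    entry-lookup i = begin
      value n (encode (Maybe.map act (decode (pos n (suc i)))))
        ≡⟨ cong (value n ∘ encode ∘ Maybe.map act) (decode-encode (just (i , Sign.+))) ⟩
      value n (encode (just (act (i , Sign.+))))
        ≡⟨ value-encode (act (i , Sign.+)) ⟩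
      ⟦ proj₁ (lookup w i) , proj₂ (lookup w i) Sign.* Sign.+ ⟧
        ≡⟨ cong (λ s → ⟦ proj₁ (lookup w i) , s ⟧) (Sign.*-identityʳ _) ⟩
      ⟦ lookup w i ⟧
        ∎

-- The list `𝔅 n` contains a function only in the form `finToFun` of its code, which agrees with it
-- pointwise.
IsSignedPermutation-resp-≗ : ∀ {π σ : ±[ n ] → ±[ n ]} → π ≗ σ →
  IsSignedPermutation π → IsSignedPermutation σ
IsSignedPermutation-resp-≗ {π = π} {σ} π≗σ π-signed = record
  { bijective = σ-injective , injective⇒surjective σ-injective
  ; odd       = λ k → trans (sym (π≗σ _)) (trans (odd k) (cong opposite (π≗σ k)))
  }
  where
  open IsSignedPermutation π-signed
  σ-injective : Injective _≡_ _≡_ σ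
  σ-injective e = proj₁ bijective (trans (π≗σ _) (trans e (sym (π≗σ _))))

-- Words enumerate the signed permutations

functions : ∀ n → List (±[ n ] → ±[ n ])
functions n = List.map finToFun (allFin ((n ℕ.+ suc n) ℕ.^ (n ℕ.+ suc n)))

𝔅-signed : ∀ n → All IsSignedPermutation (𝔅 n)
𝔅-signed n = All.all-filter isSignedPermutation? (functions n)

-- Different codes decode to functions that differ at some point, and signed permutations that
-- differ at some point have different words.
𝔅-words-unique : ∀ n → Unique (List.map (word n) (𝔅 n))
𝔅-words-unique n = AllPairs.map⁺ (AllPairs-map-All
  (λ π-signed σ-signed π≉σ → π≉σ ∘ word-injective π-signed σ-signed)
  (𝔅-signed n)
  (AllPairs.filter⁺ isSignedPermutation?
    (AllPairs.map⁺ (AllPairs.map (λ i≢j → i≢j ∘ finToFun-injective) (Unique.allFin⁺ _)))))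
  where
  funToFin-cong : ∀ {m k} {f g : Fin m → Fin k} → f ≗ g → funToFin f ≡ funToFin g
  funToFin-cong {zero}  f≗g = refl
  funToFin-cong {suc m} f≗g = cong₂ Fin.combine (f≗g zero) (funToFin-cong (f≗g ∘ suc))

  finToFun-injective : ∀ {i j} → finToFun {n ℕ.+ suc n} {n ℕ.+ suc n} i ≗ finToFun j → i ≡ j
  finToFun-injective {i} {j} e = trans (sym (Fin.funToFin-finToFin {n ℕ.+ suc n} i))
    (trans (funToFin-cong e) (Fin.funToFin-finToFin {n ℕ.+ suc n} j))

-- Both lists are free of repetitions, so it suffices that they have the same elements. Sums over
-- `𝔅 n` thereby become sums over the recursively built `words n`.
𝔅-words : ∀ n → List.map (word n) (𝔅 n) ↭ List.map (Vec.map ⟦_⟧) (words n)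
𝔅-words n = ∼bag⇒↭ (unique∧set⇒bag (𝔅-words-unique n)
  (Unique.map⁺ (map-injective ⟦⟧-injective) (words-unique n)) (mk⇔ to from))
  where
  to : ∀ {v} → v ∈ List.map (word n) (𝔅 n) → v ∈ List.map (Vec.map ⟦_⟧) (words n)
  to v∈ with π , π∈ , refl ← ∈-map⁻ (word n) v∈ =
    SignedPermutation.word∈ (proj₂ (∈-filter⁻ isSignedPermutation? {xs = functions n} π∈))

  from : ∀ {v} → v ∈ List.map (Vec.map ⟦_⟧) (words n) → v ∈ List.map (word n) (𝔅 n)
  from v∈ with w , w∈ , refl ← ∈-map⁻ (Vec.map ⟦_⟧) v∈ =
    subst (_∈ List.map (word n) (𝔅 n))
      (trans (Vec.tabulate-cong λ i → cong (value n) (sym (π≗σ (pos n (suc i))))) word-permutation)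
      (∈-map⁺ (word n) (∈-filter⁺ isSignedPermutation?
        (∈-map⁺ finToFun (∈-allFin (funToFin permutation)))
        (IsSignedPermutation-resp-≗ π≗σ permutation-signed)))
    where
    open FromWord w (∈-words⇒distinct w∈)
    π≗σ : permutation ≗ finToFun (funToFin permutation)
    π≗σ = sym ∘ Fin.finToFun-funToFin permutation

module _ {c ℓ} (R : CommutativeRing c ℓ) where
  open CommutativeRing R renaming (refl to ≈-refl; sym to ≈-sym; trans to ≈-trans)
  open DescentPolynomials R using (∑𝔅; B; F)
  open import Algebra.Properties.Ring ring using (-1*x≈-x)
  open import Algebra.Properties.AbelianGroup +-abelianGroup using (⁻¹-anti-homo‿-)
  open import Algebra.Properties.Semiring.Exp semiring using (_^_; ^-assocʳ; ^-congˡ; ^-congʳ)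
  open import Algebra.Properties.CommutativeSemiring.Exp commutativeSemiring using (^-distrib-*)
  open import Algebra.Properties.Semiring.Mult semiring using (_×_; ×-congʳ; ×-comm-*; ×-homo-+)
  open import Algebra.Properties.Semiring.Sum semiring using (*-distribˡ-sum)
  open import Algebra.Properties.CommutativeMonoid.Sum +-commutativeMonoid
  open import Algebra.Properties.CommutativeSemigroup +-commutativeSemigroup using (x∙yz≈y∙xz)
  open import Algebra.Properties.CommutativeSemigroup *-commutativeSemigroup
    using () renaming (x∙yz≈y∙xz to *x∙yz≈y∙xz; interchange to *interchange)
  open import Algebra.Solver.Ring.NaturalCoefficients.Default commutativeSemiring
    using (solve; con; _:=_; _:+_; _:*_)
  open import Relation.Binary.Reasoning.Setoid setoid

  -- Sums over lists

  listSum : ∀ {A : Set a} → (A → Carrier) → List A → Carrier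
  listSum f xs = foldr _+_ 0# (List.map f xs)

  module _ {A : Set a} where

    listSum-cong-All : ∀ {f g : A → Carrier} {xs} →
      All (λ x → f x ≈ g x) xs → listSum f xs ≈ listSum g xs
    listSum-cong-All []       = ≈-refl
    listSum-cong-All (e ∷ es) = +-cong e (listSum-cong-All es)

    listSum-cong : ∀ {f g : A → Carrier} → (∀ x → f x ≈ g x) → ∀ xs → listSum f xs ≈ listSum g xs
    listSum-cong e xs = listSum-cong-All (All.universal e xs)

    listSum-↭ : ∀ (f : A → Carrier) {xs ys} → xs ↭ ys → listSum f xs ≈ listSum f ys
    listSum-↭ f Perm.refl          = ≈-refl
    listSum-↭ f (Perm.prep x σ)    = +-congˡ (listSum-↭ f σ)
    listSum-↭ f (Perm.swap x y σ)  = ≈-trans (x∙yz≈y∙xz _ _ _) (+-congˡ (+-congˡ (listSum-↭ f σ)))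
    listSum-↭ f (Perm.trans σ τ)   = ≈-trans (listSum-↭ f σ) (listSum-↭ f τ)

    listSum-++ : ∀ (f : A → Carrier) xs ys → listSum f (xs ++ ys) ≈ listSum f xs + listSum f ys
    listSum-++ f []       ys = ≈-sym (+-identityˡ _)
    listSum-++ f (x ∷ xs) ys = ≈-trans (+-congˡ (listSum-++ f xs ys)) (≈-sym (+-assoc _ _ _))

    *-distribˡ-listSum : ∀ x (f : A → Carrier) xs → x * listSum f xs ≈ listSum (λ z → x * f z) xs
    *-distribˡ-listSum x f []       = zeroʳ x
    *-distribˡ-listSum x f (z ∷ xs) = ≈-trans (distribˡ _ _ _) (+-congˡ (*-distribˡ-listSum x f xs))

    listSum-tabulate : ∀ (f : A → Carrier) (g : Fin n → A) →
      listSum f (List.tabulate g) ≈ ∑[ i < n ] f (g i)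
    listSum-tabulate {n = zero}  f g = ≈-refl
    listSum-tabulate {n = suc n} f g = +-congˡ (listSum-tabulate f (g ∘ suc))

  listSum-map : ∀ {A : Set a} {B : Set b} (f : B → Carrier) (g : A → B) xs →
    listSum f (List.map g xs) ≡ listSum (f ∘ g) xs
  listSum-map f g xs = ≡.cong (foldr _+_ 0#) (≡.sym (List.map-∘ xs))

  listSum-cartesianProductWith : ∀ {A : Set a} {B : Set b} {D : Set p}
    (f : D → Carrier) (g : A → B → D) xs ys →
    listSum f (cartesianProductWith g xs ys) ≈ listSum (λ x → listSum (λ y → f (g x y)) ys) xs
  listSum-cartesianProductWith f g []       ys = ≈-refl
  listSum-cartesianProductWith f g (x ∷ xs) ys = ≈-trans
    (listSum-++ f (List.map (g x) ys) _)
    (+-cong (reflexive (listSum-map f (g x) ys)) (listSum-cartesianProductWith f g xs ys))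

  -- The hypothesis is restricted to signed permutations because reading `desB` and `fdes` off the
  -- word relies on π 0 = 0.
  ∑𝔅-words : ∀ n {f : (±[ n ] → ±[ n ]) → Carrier} (h : Vec ℤ n → Carrier) →
    (∀ {π} → IsSignedPermutation π → f π ≈ h (word n π)) →
    ∑𝔅 n f ≈ listSum (h ∘ Vec.map ⟦_⟧) (words n)
  ∑𝔅-words n {f} h f≈h = begin
    listSum f (𝔅 n)                                ≈⟨ listSum-cong-All (All.map f≈h (𝔅-signed n)) ⟩
    listSum (h ∘ word n) (𝔅 n)                     ≡⟨ listSum-map h (word n) (𝔅 n) ⟨
    listSum h (List.map (word n) (𝔅 n))            ≈⟨ listSum-↭ h (𝔅-words n) ⟩
    listSum h (List.map (Vec.map ⟦_⟧) (words n))   ≡⟨ listSum-map h (Vec.map ⟦_⟧) (words n) ⟩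
    listSum (h ∘ Vec.map ⟦_⟧) (words n)            ∎

  ∑-cong : ∀ n (f g : Fin n → Carrier) → (∀ i → f i ≈ g i) → ∑[ i < n ] f i ≈ ∑[ i < n ] g i
  ∑-cong n f g = sum-cong-≋

  ∑-split : ∀ n (f g : Fin n → Carrier) x →
    ∑[ i < n ] (f i + x * g i) ≈ ∑[ i < n ] f i + x * ∑[ i < n ] g i
  ∑-split n f g x = ≈-trans (∑-distrib-+ f _) (+-congˡ (≈-sym (*-distribˡ-sum x g)))

  ∑-identityˡ : ∀ n (f : Fin n → Carrier) → ∑[ i < n ] (1# * f i) ≈ ∑[ i < n ] f i
  ∑-identityˡ n f = ≈-trans (≈-sym (*-distribˡ-sum 1# f)) (*-identityˡ _)

  -- Pascal's recurrence

  module _ (d : Carrier) where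

    binomialTerm : ℕ → (ℕ → Carrier) → ℕ → Carrier
    binomialTerm n f k = ((n C k) × d ^ (n ∸ k)) * f k

    binomialSum : ℕ → (ℕ → Carrier) → Carrier
    binomialSum n f = ∑[ k ≤ n ] binomialTerm n f (toℕ k)

    binomialSum-cong : ∀ n {f g} → (∀ k → f k ≈ g k) → binomialSum n f ≈ binomialSum n g
    binomialSum-cong n {f} {g} f≈g =
      ∑-cong (suc n) (binomialTerm n f ∘ toℕ) (binomialTerm n g ∘ toℕ) λ k → *-congˡ (f≈g (toℕ k))

    -- The second summand that Pascal's rule produces. Its exponent exceeds that of the binomial
    -- term with index k + 1 by one, which yields the factor d in the recurrence.
    shiftedTerm : ℕ → (ℕ → Carrier) → ℕ → Carrier
    shiftedTerm n f k = ((n C suc k) × d ^ (n ∸ k)) * f (suc k)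

    binomialTerm-suc : ∀ n f k →
      binomialTerm (suc n) f (suc k) ≈ binomialTerm n (f ∘ suc) k + shiftedTerm n f k
    binomialTerm-suc n f k = begin
      ((suc n C suc k) × d ^ (n ∸ k)) * f (suc k)
        ≡⟨ ≡.cong (λ m → (m × d ^ (n ∸ k)) * f (suc k)) (nCk+nC[k+1]≡[n+1]C[k+1] n k) ⟨
      ((n C k ℕ.+ n C suc k) × d ^ (n ∸ k)) * f (suc k)
        ≈⟨ *-congʳ (×-homo-+ _ (n C k) (n C suc k)) ⟩
      ((n C k) × d ^ (n ∸ k) + (n C suc k) × d ^ (n ∸ k)) * f (suc k)
        ≈⟨ distribʳ _ _ _ ⟩
      binomialTerm n (f ∘ suc) k + shiftedTerm n f k ∎

    shiftedTerm-last : ∀ n f → shiftedTerm n f n ≈ 0#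
    shiftedTerm-last n f rewrite k>n⇒nCk≡0 (ℕ.n<1+n n) = zeroˡ _

    shiftedTerm-init : ∀ n f (k : Fin n) →
      shiftedTerm n f (toℕ (inject₁ k)) ≈ d * binomialTerm n f (suc (toℕ k))
    shiftedTerm-init n f k rewrite Fin.toℕ-inject₁ k = begin
      ((n C suc (toℕ k)) × d ^ (n ∸ toℕ k)) * f (suc (toℕ k))
        -- `n ∸ k` is also `suc n ∸ suc k`, and since k < n the leading 1 can be taken out of the
        -- truncated subtraction.
        ≡⟨ ≡.cong (λ e → ((n C suc (toℕ k)) × d ^ e) * f (suc (toℕ k))) (ℕ.+-∸-assoc 1 (Fin.toℕ<n k)) ⟩
      ((n C suc (toℕ k)) × (d * d ^ (n ∸ suc (toℕ k)))) * f (suc (toℕ k))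
        ≈⟨ *-congʳ (×-comm-* (n C suc (toℕ k)) d _) ⟨
      (d * ((n C suc (toℕ k)) × d ^ (n ∸ suc (toℕ k)))) * f (suc (toℕ k))
        ≈⟨ *-assoc _ _ _ ⟩
      d * binomialTerm n f (suc (toℕ k)) ∎

    binomialTerm-zero : ∀ n f → binomialTerm (suc n) f 0 ≈ d * binomialTerm n f 0
    binomialTerm-zero n f = ≈-trans (*-congʳ (≈-sym (×-comm-* 1 d _))) (*-assoc _ _ _)

    -- Pascal's rule splits each term with k > 0. The shifted halves are d times the terms of index
    -- 1 to n, the one beyond the range vanishing; the term k = 0 supplies the missing d times the
    -- term of index 0.
    binomialSum-suc : ∀ n f →
      binomialSum (suc n) f ≈ binomialSum n (f ∘ suc) + d * binomialSum n f
    binomialSum-suc n f = begin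
      binomialTerm (suc n) f 0 + ∑[ k ≤ n ] binomialTerm (suc n) f (suc (toℕ k))
        ≈⟨ +-cong (binomialTerm-zero n f) (∑-cong (suc n) _
             (λ k → binomialTerm n (f ∘ suc) (toℕ k) + shiftedTerm n f (toℕ k))
             (λ k → binomialTerm-suc n f (toℕ k))) ⟩
      d * t₀ + ∑[ k ≤ n ] (binomialTerm n (f ∘ suc) (toℕ k) + shiftedTerm n f (toℕ k))
        ≈⟨ +-congˡ (∑-distrib-+ {suc n} (binomialTerm n (f ∘ suc) ∘ toℕ) (shiftedTerm n f ∘ toℕ)) ⟩
      d * t₀ + (binomialSum n (f ∘ suc) + ∑[ k ≤ n ] shiftedTerm n f (toℕ k))
        ≈⟨ +-congˡ (+-congˡ shifted) ⟩
      d * t₀ + (binomialSum n (f ∘ suc) + d * ts)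
        ≈⟨ x∙yz≈y∙xz _ _ _ ⟩
      binomialSum n (f ∘ suc) + (d * t₀ + d * ts)
        ≈⟨ +-congˡ (distribˡ _ _ _) ⟨
      binomialSum n (f ∘ suc) + d * (t₀ + ts) ∎
      where
      t₀ ts : Carrier
      t₀ = binomialTerm n f 0
      ts = ∑[ k < n ] binomialTerm n f (suc (toℕ k))

      shifted : ∑[ k ≤ n ] shiftedTerm n f (toℕ k) ≈ d * ts
      shifted = begin
        ∑[ k ≤ n ] shiftedTerm n f (toℕ k)
          ≈⟨ sum-init-last {n} (shiftedTerm n f ∘ toℕ) ⟩
        ∑[ k < n ] shiftedTerm n f (toℕ (inject₁ k)) + shiftedTerm n f (toℕ (fromℕ n))
          ≡⟨ ≡.cong (λ k → ∑[ k < n ] shiftedTerm n f (toℕ (inject₁ k)) + shiftedTerm n f k) (Fin.toℕ-fromℕ n) ⟩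
        ∑[ k < n ] shiftedTerm n f (toℕ (inject₁ k)) + shiftedTerm n f n
          ≈⟨ +-cong (∑-cong n _ _ (shiftedTerm-init n f)) (shiftedTerm-last n f) ⟩
        ∑[ k < n ] (d * binomialTerm n f (suc (toℕ k))) + 0#
          ≈⟨ +-identityʳ _ ⟩
        ∑[ k < n ] (d * binomialTerm n f (suc (toℕ k)))
          ≈⟨ *-distribˡ-sum {n} d _ ⟨
        d * ts ∎

    -- Writing the second index as i + m builds in the bound i ≤ n. The induction on i runs over all
    -- m at once, as the recurrence calls for both m + 1 and m.
    pascal⇒binomialSum : ∀ (A : ℕ → ℕ → Carrier) →
      (∀ i n → i ℕ.≤ n → A (suc i) (suc n) ≈ A i (suc n) + d * A i n) →
      ∀ i m → A i (i ℕ.+ m) ≈ binomialSum i (λ k → A 0 (k ℕ.+ m))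
    pascal⇒binomialSum A pascal zero m = begin
      A 0 m                      ≈⟨ *-identityˡ _ ⟨
      1# * A 0 m                 ≈⟨ *-congʳ (+-identityʳ 1#) ⟨
      (1# + 0#) * A 0 m          ≈⟨ +-identityʳ _ ⟨
      (1# + 0#) * A 0 m + 0#     ∎
    pascal⇒binomialSum A pascal (suc i) m = begin
      A (suc i) (suc (i ℕ.+ m))
        ≈⟨ pascal i (i ℕ.+ m) (ℕ.m≤m+n i m) ⟩
      A i (suc (i ℕ.+ m)) + d * A i (i ℕ.+ m)
        ≡⟨ ≡.cong (λ j → A i j + d * A i (i ℕ.+ m)) (ℕ.+-suc i m) ⟨
      A i (i ℕ.+ suc m) + d * A i (i ℕ.+ m)
        ≈⟨ +-cong (pascal⇒binomialSum A pascal i (suc m)) (*-congˡ (pascal⇒binomialSum A pascal i m)) ⟩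
      binomialSum i (λ k → A 0 (k ℕ.+ suc m)) + d * binomialSum i (λ k → A 0 (k ℕ.+ m))
        ≈⟨ +-congʳ (binomialSum-cong i λ k → reflexive (≡.cong (A 0) (ℕ.+-suc k m))) ⟩
      binomialSum i (λ k → A 0 (suc (k ℕ.+ m))) + d * binomialSum i (λ k → A 0 (k ℕ.+ m))
        ≈⟨ binomialSum-suc i (λ k → A 0 (k ℕ.+ m)) ⟨
      binomialSum (suc i) (λ k → A 0 (k ℕ.+ m)) ∎

  -- Generating functions of words

  when : Bool → Carrier → Carrier
  when b x = if b then x else 1#

  ^-step : ∀ b x i → x ^ (if b then suc else id) i ≈ when b x * x ^ i
  ^-step true  x i = ≈-refl
  ^-step false x i = ≈-sym (*-identityˡ _)

  module _ (y s : Carrier) where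

    -- The preceding letter `p` may cause a descent, but its own sign is not counted.
    weight : ℤ → Vec ℤ k → Carrier
    weight p v = y ^ negs v * s ^ desAfter p v

    W : ℤ → ℕ → Carrier
    W p n = listSum (weight p ∘ Vec.map ⟦_⟧) (words n)

    -- A preceding letter enters only through the number i of smaller absolute
    -- values among the remaining letters.

    W⁺ W⁻ : ℕ → ℕ → Carrier
    W⁺ i = W +[1+ i ]
    W⁻ i = W (ℤ.- (+ i))

    ∑⁻ : ℕ → Carrier
    ∑⁻ n = ∑[ r ≤ n ] W⁻ (toℕ r) n

    ∑⁺ : ℕ → Carrier
    ∑⁺ n = ∑[ r ≤ n ] W⁺ (toℕ r) n

    -- The common source of the recursions for `W⁺` and for `F`. In both, the word follows a
    -- nonnegative entry, so a negative first letter is always a descent and its factor x does not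
    -- depend on its rank.
    sum-by-first-letter : ∀ n (h : Vec ℤ (suc n) → Carrier) (g : Fin (suc n) → Carrier) x →
      (∀ r w → h (Vec.map ⟦_⟧ ((r , Sign.+) ◂ w)) ≈ g r * weight (gap (r , Sign.+)) (Vec.map ⟦_⟧ w)) →
      (∀ r w → h (Vec.map ⟦_⟧ ((r , Sign.-) ◂ w)) ≈ x * weight (gap (r , Sign.-)) (Vec.map ⟦_⟧ w)) →
      listSum (h ∘ Vec.map ⟦_⟧) (words (suc n)) ≈
      ∑[ r ≤ n ] (g r * W⁺ (toℕ r) n) + x * ∑⁻ n
    sum-by-first-letter n h g x h⁺ h⁻ = begin
      listSum (h ∘ Vec.map ⟦_⟧) (words (suc n))
        ≈⟨ listSum-cartesianProductWith (h ∘ Vec.map ⟦_⟧) _◂_ (letters (suc n)) (words n) ⟩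
      listSum (λ l → listSum (λ w → h (Vec.map ⟦_⟧ (l ◂ w))) (words n)) (letters (suc n))
        ≈⟨ listSum-cong first-letter (letters (suc n)) ⟩
      listSum (λ l → factor l * W (gap l) n) (letters (suc n))
        ≈⟨ listSum-cartesianProductWith (λ l → factor l * W (gap l) n) _,_
             (allFin (suc n)) (Sign.+ ∷ Sign.- ∷ []) ⟩
      listSum (λ r → f⁺ r + (x * f⁻ r + 0#)) (allFin (suc n))
        ≈⟨ listSum-cong (λ r → +-congˡ (+-identityʳ _)) (allFin (suc n)) ⟩
      listSum (λ r → f⁺ r + x * f⁻ r) (allFin (suc n))
        ≈⟨ listSum-tabulate {n = suc n} (λ r → f⁺ r + x * f⁻ r) id ⟩
      ∑[ r ≤ n ] (f⁺ r + x * f⁻ r)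
        ≈⟨ ∑-split (suc n) f⁺ f⁻ x ⟩
      ∑[ r ≤ n ] f⁺ r + x * ∑⁻ n ∎
      where
      factor : Letter (suc n) → Carrier
      factor (r , Sign.+) = g r
      factor (_ , Sign.-) = x

      f⁺ f⁻ : Fin (suc n) → Carrier
      f⁺ r = g r * W⁺ (toℕ r) n
      f⁻ r = W⁻ (toℕ r) n

      first-letter : ∀ l → listSum (λ w → h (Vec.map ⟦_⟧ (l ◂ w))) (words n) ≈ factor l * W (gap l) n
      first-letter l@(r , Sign.+) = ≈-trans (listSum-cong (h⁺ r) (words n))
        (≈-sym (*-distribˡ-listSum (g r) (weight (gap l) ∘ Vec.map ⟦_⟧) (words n)))
      first-letter l@(r , Sign.-) = ≈-trans (listSum-cong (h⁻ r) (words n))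
        (≈-sym (*-distribˡ-listSum x (weight (gap l) ∘ Vec.map ⟦_⟧) (words n)))

    -- A positive first letter of rank r is a descent exactly if r < i; a negative one always is,
    -- and it also contributes y.
    W⁺-suc : ∀ i n → W⁺ i (suc n) ≈
      ∑[ r ≤ n ] (when (toℕ r <ᵇ i) s * W⁺ (toℕ r) n) + (y * s) * ∑⁻ n
    W⁺-suc i n = sum-by-first-letter n (weight +[1+ i ]) (λ r → when (toℕ r <ᵇ i) s) (y * s)
      (λ r w → begin
        y ^ negs (Vec.map ⟦_⟧ ((r , Sign.+) ◂ w)) * s ^ desAfter +[1+ i ] (Vec.map ⟦_⟧ ((r , Sign.+) ◂ w))
          ≈⟨ *-cong (^-congʳ y (negs-shift r w)) (≈-trans
               (^-congʳ s (desAfter-◂ +[1+ i ] (r , Sign.+) w))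
               (^-step (toℕ r <ᵇ i) s _)) ⟩
        y ^ negs (Vec.map ⟦_⟧ w) * (when (toℕ r <ᵇ i) s * s ^ desAfter +[1+ toℕ r ] (Vec.map ⟦_⟧ w))
          ≈⟨ *x∙yz≈y∙xz _ _ _ ⟩
        when (toℕ r <ᵇ i) s * weight +[1+ toℕ r ] (Vec.map ⟦_⟧ w) ∎)
      (λ r w → ≈-trans
        (*-cong (*-congˡ (^-congʳ y (negs-shift r w)))
          (^-congʳ s (desAfter-◂ +[1+ i ] (r , Sign.-) w)))
        (*interchange _ _ _ _))

    W⁺-zero : ∀ n → W⁺ 0 (suc n) ≈ ∑⁺ n + (y * s) * ∑⁻ n
    W⁺-zero n = ≈-trans (W⁺-suc 0 n) (+-congʳ (∑-identityˡ (suc n) λ r → W⁺ (toℕ r) n))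

    -- Every rank r ≤ n is below n + 1, so every first letter is a descent.
    W⁺-top : ∀ n → W⁺ (suc n) (suc n) ≈ s * ∑⁺ n + (y * s) * ∑⁻ n
    W⁺-top n = ≈-trans (W⁺-suc (suc n) n) (+-congʳ (≈-trans
      (∑-cong (suc n) _ (λ r → s * W⁺ (toℕ r) n) λ r → *-congʳ (reflexive
        (≡.cong (λ b → when b s) (dec-true (toℕ r ℕ.<? suc n) (Fin.toℕ<n r)))))
      (≈-sym (*-distribˡ-sum {suc n} s λ r → W⁺ (toℕ r) n))))

    module _ {d} (s≈1+d : s ≈ 1# + d) where

      -- Raising the threshold from i to i + 1 affects the single term r = i, whose factor changes
      -- from 1 to s = 1 + d.
      sum-when-suc : ∀ (f : ℕ → Carrier) {i n} → i ℕ.< n →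
        ∑[ r < n ] (when (toℕ r <ᵇ suc i) s * f (toℕ r)) ≈
        ∑[ r < n ] (when (toℕ r <ᵇ i) s * f (toℕ r)) + d * f i
      sum-when-suc f {zero}  {suc n} _ = begin
        s * f 0 + rest              ≈⟨ +-congʳ (*-congʳ s≈1+d) ⟩
        (1# + d) * f 0 + rest       ≈⟨ solve 3 (λ d f r → (con 1 :+ d) :* f :+ r :=
                                         (con 1 :* f :+ r) :+ d :* f) ≈-refl d (f 0) rest ⟩
        (1# * f 0 + rest) + d * f 0 ∎
        where
        rest : Carrier
        rest = ∑[ r < n ] (1# * f (suc (toℕ r)))
      sum-when-suc f {suc i} {suc n} (ℕ.s≤s i<n) =
        ≈-trans (+-congˡ (sum-when-suc (f ∘ suc) i<n)) (≈-sym (+-assoc _ _ _))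

      -- The part with negative first letter is independent of i, so only the threshold in the
      -- positive part matters; i ≤ n ensures that rank i occurs in the sum.
      W⁺-pascal : ∀ i n → i ℕ.≤ n → W⁺ (suc i) (suc n) ≈ W⁺ i (suc n) + d * W⁺ i n
      W⁺-pascal i n i≤n = begin
        W⁺ (suc i) (suc n)                  ≈⟨ W⁺-suc (suc i) n ⟩
        S (suc i) + (y * s) * ∑⁻ n          ≈⟨ +-congʳ (sum-when-suc (λ r → W⁺ r n) {i} {suc n} (ℕ.s≤s i≤n)) ⟩
        (S i + d * W⁺ i n) + (y * s) * ∑⁻ n ≈⟨ solve 3 (λ a b c → (a :+ b) :+ c := (a :+ c) :+ b) ≈-refl _ _ _ ⟩
        (S i + (y * s) * ∑⁻ n) + d * W⁺ i n ≈⟨ +-congʳ (W⁺-suc i n) ⟨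
        W⁺ i (suc n) + d * W⁺ i n           ∎
        where
        S : ℕ → Carrier
        S j = ∑[ r ≤ n ] (when (toℕ r <ᵇ j) s * W⁺ (toℕ r) n)

    -- No letter has value 0, so a preceding 0 can be replaced by a preceding 1.

    B≈W⁺ : ∀ n → B n y s ≈ W⁺ 0 n
    B≈W⁺ zero    = ≈-sym (≈-trans (+-identityʳ _) (*-identityˡ _))
    B≈W⁺ (suc n) = ≈-trans
      (∑𝔅-words (suc n) (weight 0ℤ) λ {π} π-signed → *-cong
        (^-congʳ y (neg-word {suc n} π))
        (^-congʳ s (SignedPermutation.desB-word {suc n} π-signed)))
      (listSum-cong (λ w → *-congˡ (^-congʳ s (zero≡one w))) (words (suc n)))
      where
      zero≡one : ∀ (w : Vec (Letter (suc n)) (suc n)) →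
        desAfter 0ℤ (Vec.map ⟦_⟧ w) ≡ desAfter +[1+ 0 ] (Vec.map ⟦_⟧ w)
      zero≡one ((_ , Sign.+) ∷ _) = ≡.refl
      zero≡one ((_ , Sign.-) ∷ _) = ≡.refl

    -- The alternating binomial sum

    alternatingSum : ℕ → Carrier
    alternatingSum n = ∑[ k ≤ n ]
      ((- 1#) ^ (n ∸ toℕ k) * ((n C toℕ k) × ((1# - s) ^ (n ∸ toℕ k))) * B (toℕ k) y s)

    -- The signs turn powers of 1 - s into powers of s - 1, which gives the binomial solution of
    -- Pascal's recurrence with d = s - 1.
    alternatingSum≈W⁺ : ∀ n → alternatingSum n ≈ W⁺ n n
    alternatingSum≈W⁺ n = begin
      alternatingSum n
        -- The diagonal entry is the case i = n, m = 0 of the solution, hence the index `k ℕ.+ 0`.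
        ≈⟨ ∑-cong (suc n) _ (binomialTerm (s - 1#) n (λ k → W⁺ 0 (k ℕ.+ 0)) ∘ toℕ)
             (λ k → *-cong (signs (n C toℕ k) (n ∸ toℕ k)) (≈-trans (B≈W⁺ (toℕ k))
             (reflexive (≡.cong (W⁺ 0) (≡.sym (ℕ.+-identityʳ (toℕ k))))))) ⟩
      binomialSum (s - 1#) n (λ k → W⁺ 0 (k ℕ.+ 0))
        ≈⟨ pascal⇒binomialSum (s - 1#) W⁺ (W⁺-pascal s≈1+[s-1]) n 0 ⟨
      W⁺ n (n ℕ.+ 0)
        ≡⟨ ≡.cong (W⁺ n) (ℕ.+-identityʳ n) ⟩
      W⁺ n n ∎
      where
      s≈1+[s-1] : s ≈ 1# + (s - 1#)
      s≈1+[s-1] = begin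
        s                ≈⟨ +-identityʳ s ⟨
        s + 0#           ≈⟨ +-congˡ (-‿inverseʳ 1#) ⟨
        s + (1# - 1#)    ≈⟨ x∙yz≈y∙xz s 1# (- 1#) ⟩
        1# + (s - 1#)    ∎

      signs : ∀ c j → (- 1#) ^ j * (c × ((1# - s) ^ j)) ≈ c × ((s - 1#) ^ j)
      signs c j = begin
        (- 1#) ^ j * (c × ((1# - s) ^ j))  ≈⟨ ×-comm-* c _ _ ⟩
        c × ((- 1#) ^ j * (1# - s) ^ j)    ≈⟨ ×-congʳ c (^-distrib-* _ _ j) ⟨
        c × ((- 1# * (1# - s)) ^ j)        ≈⟨ ×-congʳ c (^-congˡ j (≈-trans (-1*x≈-x _) (⁻¹-anti-homo‿- 1# s))) ⟩
        c × ((s - 1#) ^ j)                 ∎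

  -- Flag descents and the identity in a commutative ring

  module _ (y t : Carrier) where

    flagWeight : Vec ℤ (suc k) → Carrier
    flagWeight v = y ^ negs v * t ^ fdesᵥ v

    -- Later descents count twice, hence s = t². A positive first letter is no descent after 0; a
    -- negative one is, but it adds 2 - 1 to the flag descent number, giving y t instead of y t².
    F-suc : ∀ n → F (suc n) y t ≈ ∑⁺ y (t ^ 2) n + (y * t) * ∑⁻ y (t ^ 2) n
    F-suc n = begin
      F (suc n) y t
        ≈⟨ ∑𝔅-words (suc n) flagWeight (λ {π} π-signed → *-cong
             (^-congʳ y (neg-word {suc n} π)) (^-congʳ t (fdes-word {n} π-signed))) ⟩
      listSum (flagWeight ∘ Vec.map ⟦_⟧) (words (suc n))
        ≈⟨ sum-by-first-letter y (t ^ 2) n flagWeight (λ _ → 1#) (y * t) positive negative ⟩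
      ∑[ r ≤ n ] (1# * W⁺ y (t ^ 2) (toℕ r) n) + (y * t) * ∑⁻ y (t ^ 2) n
        ≈⟨ +-congʳ (∑-identityˡ (suc n) λ r → W⁺ y (t ^ 2) (toℕ r) n) ⟩
      ∑⁺ y (t ^ 2) n + (y * t) * ∑⁻ y (t ^ 2) n ∎
      where
      positive : ∀ r w → flagWeight (Vec.map ⟦_⟧ ((r , Sign.+) ◂ w)) ≈
        1# * weight y (t ^ 2) (gap (r , Sign.+)) (Vec.map ⟦_⟧ w)
      positive r w = ≈-trans
        (*-cong (^-congʳ y (negs-shift r w)) (≈-trans
          (^-congʳ t (≡.cong (2 ℕ.*_) (desAfter-◂ 0ℤ (r , Sign.+) w)))
          (≈-sym (^-assocʳ t 2 (desAfter (gap (r , Sign.+)) (Vec.map ⟦_⟧ w))))))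
        (≈-sym (*-identityˡ _))

      negative : ∀ r w → flagWeight (Vec.map ⟦_⟧ ((r , Sign.-) ◂ w)) ≈
        (y * t) * weight y (t ^ 2) (gap (r , Sign.-)) (Vec.map ⟦_⟧ w)
      negative r w = ≈-trans
        (*-cong (*-congˡ (^-congʳ y (negs-shift r w))) (≈-trans
          (^-congʳ t (≡.trans (≡.cong (λ d → 2 ℕ.* d ∸ 1) (desAfter-◂ 0ℤ (r , Sign.-) w))
            -- `2 ℕ.* suc e ∸ 1` computes to `e ℕ.+ suc (e ℕ.+ 0)`, one more than `2 ℕ.* e`.
            (ℕ.+-suc e (e ℕ.+ 0))))
          (*-congˡ (≈-sym (^-assocʳ t 2 e)))))
        (*interchange _ _ _ _)
        where
        e : ℕ
        e = desAfter (gap (r , Sign.-)) (Vec.map ⟦_⟧ w)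

    -- Here u and v invert 1 + t and t. Multiplying the alternating sum t² P + y t² Q by v leaves t
    -- P + y t Q; adding B, which is P + y t² Q, gives (1 + t)(P + y t Q), and u cancels the first
    -- factor.
    F-formula : ∀ {u v} → u * (1# + t) ≈ 1# → v * t ≈ 1# → ∀ n .{{_ : NonZero n}} →
      F n y t ≈ u * (B n y (t ^ 2) + v * alternatingSum y (t ^ 2) n)
    F-formula {u} {v} u-inverse v-inverse n@(suc m) = ≈-sym (begin
      u * (B n y (t ^ 2) + v * alternatingSum y (t ^ 2) n)
        ≈⟨ *-congˡ (+-cong
             (≈-trans (B≈W⁺ y (t ^ 2) n) (W⁺-zero y (t ^ 2) m))
             (*-congˡ (≈-trans (alternatingSum≈W⁺ y (t ^ 2) n) (W⁺-top y (t ^ 2) m)))) ⟩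
      u * ((P + (y * (t * (t * 1#))) * Q) + v * ((t * (t * 1#)) * P + (y * (t * (t * 1#))) * Q))
        ≈⟨ solve 6 (λ u v y t P Q →
             u :* ((P :+ (y :* (t :* (t :* con 1))) :* Q) :+
               v :* ((t :* (t :* con 1)) :* P :+ (y :* (t :* (t :* con 1))) :* Q)) :=
             u :* ((P :+ (y :* t :* t) :* Q) :+ (v :* t) :* (t :* P :+ (y :* t) :* Q)))
             ≈-refl u v y t P Q ⟩
      u * ((P + (y * t * t) * Q) + (v * t) * (t * P + (y * t) * Q))
        ≈⟨ *-congˡ (+-congˡ (*-congʳ v-inverse)) ⟩
      u * ((P + (y * t * t) * Q) + 1# * (t * P + (y * t) * Q))
        ≈⟨ solve 5 (λ u y t P Q →
             u :* ((P :+ (y :* t :* t) :* Q) :+ con 1 :* (t :* P :+ (y :* t) :* Q)) :=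
             (u :* (con 1 :+ t)) :* (P :+ (y :* t) :* Q))
             ≈-refl u y t P Q ⟩
      (u * (1# + t)) * (P + (y * t) * Q)
        ≈⟨ *-congʳ u-inverse ⟩
      1# * (P + (y * t) * Q)
        ≈⟨ *-identityˡ _ ⟩
      P + (y * t) * Q
        ≈⟨ F-suc m ⟨
      F n y t ∎)
      where
      P Q : Carrier
      P = ∑⁺ y (t ^ 2) m
      Q = ∑⁻ y (t ^ 2) m

-- The identity of rational functions

open import Defs

theorem2p9 : (n : ℕ) .{{_ : NonZero n}} →
    F n y t ≈
    (1# + t) ⁻¹⟨ 1+t≉0 ⟩ *
    (B n y (t ^ 2) +
    t ⁻¹⟨ t≉0 ⟩ *
    (∑[ k ≤ n ]
    ((- 1#) ^ (n ∸ toℕ k) * ((n C toℕ k) × ((1# - t ^ 2) ^ (n ∸ toℕ k)))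
    * B (toℕ k) y (t ^ 2))))
theorem2p9 = F-formula ℚ⟨y,t⟩ y t {(1# + t) ⁻¹⟨ 1+t≉0 ⟩} {t ⁻¹⟨ t≉0 ⟩}
  (⁻¹-inverseˡ (1# + t) 1+t≉0) (⁻¹-inverseˡ t t≉0)
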